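{- Let $n,k$ be positive integers with $n\geq 2k+1$, let $t\in\{0,1,\dots,k-1\}$ and $S=\{0,1,\dots,t\}$. Then \[Z(J_S(n,k))\geq\binom{n}{k}-\binom{2k-2t}{k-t}.\]
   Context: For $S\subseteq\{0,1,\dots,k-1\}$, the generalized Johnson graph $J_S(n,k)$ is the simple graph whose vertices are the $k$-element subsets of $\{1,\dots,n\}$, two distinct vertices being adjacent if and only if the size of their intersection lies in $S$. Zero forcing on a graph $G$: start with a set of black vertices, all others white; repeatedly, if a black vertex $v$ has exactly one white neighbor $w$, color $w$ black. A zero forcing set is an initial black set for which this eventually colors all vertices black; $Z(G)$ is the minimum size of a zero forcing set. -}

module Defs where

open import Data.Nat using (ℕ; _≤_; _<_)
open import Data.Fin using (Fin)
open import Data.Fin.Subset using (Subset; ∣_∣; _∩_)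
open import Data.Product using (Σ; proj₁; _×_; ∃)
open import Data.List using (List; map)
open import Data.List.Membership.Propositional using (_∈_)
open import Relation.Binary.PropositionalEquality using (_≡_; _≢_)

KSubset : ℕ → ℕ → Set
KSubset n k = Σ (Subset n) (λ s → ∣ s ∣ ≡ k)

JAdj : (n k : ℕ) → (ℕ → Set) → KSubset n k → KSubset n k → Set
JAdj n k S u v = (proj₁ u ≢ proj₁ v) × S ∣ proj₁ u ∩ proj₁ v ∣

UpTo : ℕ → ℕ → Set
UpTo t i = i ≤ t

-- Zero forcing on a graph with vertex type V and adjacency relation Adj.
-- Forced B v : v ends up black when starting from the black set B
-- (the least set containing B closed under the colour-change rule:
-- a black vertex u all of whose neighbours other than w are black
-- forces its neighbour w).
data Forced {V : Set} (Adj : V → V → Set) (B : List V) : V → Set where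
  initial : ∀ {v} → v ∈ B → Forced Adj B v
  force   : ∀ {u w} → Forced Adj B u → Adj u w →
            (∀ x → Adj u x → x ≢ w → Forced Adj B x) →
            Forced Adj B w

IsZeroForcingSet : {V : Set} → (V → V → Set) → List V → Set
IsZeroForcingSet {V} Adj B = ∀ (v : V) → Forced Adj B v

{-# OPTIONS --safe #-}
module Submission where

-- Write k = t + d. Attach vectors of ℤ^(t+2d) to the points 1, …, n, and send a k-set A to
-- the coefficient of e₀ ∧ ⋯ ∧ e_{t-1} in the wedge ω_A of the vectors of its points; it has
-- degree d over the remaining 2d coordinates, so it lives in a space of dimension C(2d,d).
-- The pairing Φ(A,B) of two such elements into the volume form vanishes as soon as
-- ∣A ∩ B∣ > t (Füredi), and for generic vectors it is nonzero whenever ∣A ∩ B∣ ≤ t.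
-- Hence Φ is a matrix of rank at most C(2d,d) whose nonzero entries are exactly the edges of
-- the graph. If a zero forcing set had fewer than C(n,k) − C(2d,d) elements, some nonzero
-- vector in the kernel of Φ would vanish on it; but each force u → w preserves the vanishing,
-- because row u of the kernel equation reduces to Φ(u,w) x_w = 0.

module Pairing where

  open import Data.Nat as ℕ using (ℕ; zero; suc; z≤n; s≤s; _<_; _≤_)
  import Data.Nat.Properties as ℕ
  open import Data.Integer using (ℤ; 0ℤ; 1ℤ; -1ℤ; _+_; _*_; -_)
  open import Data.Integer.Properties using (_≟_; +-*-semiring; +-identityˡ; +-identityʳ; *-assoc; *-comm; *-identityˡ; *-identityʳ; *-zeroʳ; i*j≡0⇒i≡0∨j≡0)
  open import Data.Integer.Tactic.RingSolver using (solve-∀)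
  open import Data.Fin using (Fin; zero; suc; _↑ˡ_; _↑ʳ_)
  import Data.Fin.Properties as Fin
  open import Data.Fin.Subset using (Subset; ∣_∣; _∩_; ∁; _∈_; _∉_; inside; outside; ⊥)
  open import Data.Fin.Subset.Properties using (_∈?_; drop-there; x∈p∩q⁻; ∣p∩q∣≤∣p∣; ∣p∩q∣≤∣q∣; ∣∁p∣≡n∸∣p∣; ∣⊥∣≡0; ∩-comm)
  open import Data.Vec using ([]; _∷_; _++_; replicate; here; there; _[_]≔_)
  open import Data.Product using (∃; _×_; _,_; proj₁; proj₂)
  open import Data.Sum using (_⊎_; inj₁; inj₂)
  open import Function using (_∘_)
  open import Relation.Nullary using (yes; no; contradiction; _×-dec_; ¬?)
  open import Relation.Nullary.Decidable using (decidable-stable)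
  open import Relation.Binary.PropositionalEquality
  open import Algebra.Properties.Semiring.Sum +-*-semiring using (sum; sum-cong-≗; sum-replicate-zero)
  open ≡-Reasoning

  private variable
    m n M N d : ℕ

  -- Linear relations

  Vector : ℕ → Set
  Vector M = Fin M → ℤ

  δ : Fin M → Vector M
  δ zero    zero    = 1ℤ
  δ zero    (suc r) = 0ℤ
  δ (suc i) zero    = 0ℤ
  δ (suc i) (suc r) = δ i r

  sum-zero : (f : Vector n) → (∀ j → f j ≡ 0ℤ) → sum f ≡ 0ℤ
  sum-zero {n} f f≡0 = trans (sum-cong-≗ f≡0) (sum-replicate-zero n)

  sum-single : (f : Vector n) (p : Fin n) → (∀ j → j ≢ p → f j ≡ 0ℤ) → sum f ≡ f p
  sum-single f zero    h =
    trans (cong (_+_ (f zero)) (sum-zero (f ∘ suc) (λ j → h (suc j) λ ()))) (+-identityʳ (f zero))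
  sum-single f (suc p) h = begin
    f zero + sum (f ∘ suc) ≡⟨ cong₂ _+_ (h zero λ ())
                                (sum-single (f ∘ suc) p λ j j≢p → h (suc j) (j≢p ∘ Fin.suc-injective)) ⟩
    0ℤ + f (suc p)         ≡⟨ +-identityˡ (f (suc p)) ⟩
    f (suc p)              ∎

  δ-same : (p : Fin n) → δ p p ≡ 1ℤ
  δ-same zero    = refl
  δ-same (suc p) = δ-same p

  δ-other : (p j : Fin n) → j ≢ p → δ p j ≡ 0ℤ
  δ-other zero    zero    j≢p = contradiction refl j≢p
  δ-other zero    (suc j) j≢p = refl
  δ-other (suc p) zero    j≢p = refl
  δ-other (suc p) (suc j) j≢p = δ-other p j (j≢p ∘ cong suc)

  infix 8 _∙_
  _∙_ : Vector n → Vector n → ℤ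
  c ∙ ℓ = sum λ j → c j * ℓ j

  ∙-linˡ : ∀ a (c : Vector n) b d ℓ → (λ j → a * c j + b * d j) ∙ ℓ ≡ a * c ∙ ℓ + b * d ∙ ℓ
  ∙-linˡ {zero}  a c b d ℓ = lemma a b
    where
    lemma : ∀ a b → 0ℤ ≡ a * 0ℤ + b * 0ℤ
    lemma = solve-∀
  ∙-linˡ {suc n} a c b d ℓ rewrite ∙-linˡ a (c ∘ suc) b (d ∘ suc) (ℓ ∘ suc) =
    lemma a (c zero) b (d zero) (ℓ zero) ((c ∘ suc) ∙ (ℓ ∘ suc)) ((d ∘ suc) ∙ (ℓ ∘ suc))
    where
    lemma : ∀ a c b d l x y → (a * c + b * d) * l + (a * x + b * y) ≡ a * (c * l + x) + b * (d * l + y)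
    lemma = solve-∀

  ∙-comm : (c d : Vector n) → c ∙ d ≡ d ∙ c
  ∙-comm c d = sum-cong-≗ λ j → *-comm (c j) (d j)

  ∙-linʳ : ∀ (ℓ : Vector n) a c b d → ℓ ∙ (λ j → a * c j + b * d j) ≡ a * ℓ ∙ c + b * ℓ ∙ d
  ∙-linʳ ℓ a c b d = begin
    ℓ ∙ (λ j → a * c j + b * d j)  ≡⟨ ∙-comm ℓ (λ j → a * c j + b * d j) ⟩
    (λ j → a * c j + b * d j) ∙ ℓ  ≡⟨ ∙-linˡ a c b d ℓ ⟩
    a * c ∙ ℓ + b * d ∙ ℓ          ≡⟨ cong₂ (λ x y → a * x + b * y) (∙-comm c ℓ) (∙-comm d ℓ) ⟩
    a * ℓ ∙ c + b * ℓ ∙ d          ∎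

  ∙-δʳ : (c : Vector n) (p : Fin n) → c ∙ δ p ≡ c p
  ∙-δʳ c p = begin
    c ∙ δ p     ≡⟨ sum-single (λ j → c j * δ p j) p
                     (λ j j≢p → trans (cong (c j *_) (δ-other p j j≢p)) (*-zeroʳ (c j))) ⟩
    c p * δ p p ≡⟨ cong (c p *_) (δ-same p) ⟩
    c p * 1ℤ    ≡⟨ *-identityʳ (c p) ⟩
    c p         ∎

  *-nonZero : ∀ {i j} → i ≢ 0ℤ → j ≢ 0ℤ → i * j ≢ 0ℤ
  *-nonZero {i} i≢0 j≢0 ij≡0 with i*j≡0⇒i≡0∨j≡0 i ij≡0
  ... | inj₁ i≡0 = i≢0 i≡0
  ... | inj₂ j≡0 = j≢0 j≡0

  *-cancel-zero : ∀ {i j} → i ≢ 0ℤ → i * j ≡ 0ℤ → j ≡ 0ℤ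
  *-cancel-zero {i} i≢0 ij≡0 with i*j≡0⇒i≡0∨j≡0 i ij≡0
  ... | inj₁ i≡0 = contradiction i≡0 i≢0
  ... | inj₂ j≡0 = j≡0

  infixl 8 _∖_
  _∖_ : Subset n → Fin n → Subset n
  p ∖ i = p [ i ]≔ outside

  ∣p∖i∣ : {p : Subset n} {i : Fin n} → i ∈ p → ∣ p ∣ ≡ suc ∣ p ∖ i ∣
  ∣p∖i∣ here                          = refl
  ∣p∖i∣ {p = inside ∷ _}  (there i∈p) = cong suc (∣p∖i∣ i∈p)
  ∣p∖i∣ {p = outside ∷ _} (there i∈p) = ∣p∖i∣ i∈p

  i∉p∖i : (p : Subset n) (i : Fin n) → i ∉ p ∖ i
  i∉p∖i (_ ∷ p) zero    ()
  i∉p∖i (_ ∷ p) (suc i) (there i∈) = i∉p∖i p i i∈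

  ∈p∖i⇒∈p : (p : Subset n) (i : Fin n) {j : Fin n} → j ∈ p ∖ i → j ∈ p
  ∈p∖i⇒∈p (_ ∷ p) zero    (there j∈) = there j∈
  ∈p∖i⇒∈p (_ ∷ p) (suc i) here       = here
  ∈p∖i⇒∈p (_ ∷ p) (suc i) (there j∈) = there (∈p∖i⇒∈p p i j∈)

  ∈p⇒∈p∖i : (p : Subset n) (i : Fin n) {j : Fin n} → j ≢ i → j ∈ p → j ∈ p ∖ i
  ∈p⇒∈p∖i (_ ∷ p) zero    j≢i here       = contradiction refl j≢i
  ∈p⇒∈p∖i (_ ∷ p) zero    j≢i (there j∈) = there j∈
  ∈p⇒∈p∖i (_ ∷ p) (suc i) j≢i here       = here
  ∈p⇒∈p∖i (_ ∷ p) (suc i) j≢i (there j∈) = there (∈p⇒∈p∖i p i (j≢i ∘ cong suc) j∈)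

  ∣p∣>0⇒∃∈ : (p : Subset n) → 0 < ∣ p ∣ → ∃ λ i → i ∈ p
  ∣p∣>0⇒∃∈ (inside ∷ p)  _ = zero , here
  ∣p∣>0⇒∃∈ (outside ∷ p) h = let i , i∈p = ∣p∣>0⇒∃∈ p h in suc i , there i∈p

  -- Restricting the unknowns by a subset `C`, instead of shrinking their index type, lets
  -- elimination delete an unknown without renumbering the others. The pivot witnesses
  -- nontriviality.
  record Relation (L : Fin m → Vector n) (C : Subset n) : Set where
    field
      coeff     : Vector n
      support   : ∀ j → j ∉ C → coeff j ≡ 0ℤ
      pivot     : Fin n
      nonzero   : coeff pivot ≢ 0ℤ
      vanishing : ∀ i → coeff ∙ L i ≡ 0ℤ

    pivot∈ : pivot ∈ C
    pivot∈ = decidable-stable (pivot ∈? C) λ pivot∉ → nonzero (support pivot pivot∉)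

  open Relation

  -- Gaussian elimination of the first equation: if it does not involve the unknowns
  -- in C, it can be dropped; otherwise an unknown p with nonzero coefficient is eliminated.
  extend-relation : (L : Fin (suc m) → Vector n) (C : Subset n) →
                    (∀ j → j ∈ C → L zero j ≡ 0ℤ) → Relation (L ∘ suc) C → Relation L C
  extend-relation L C L₀≡0 R = record
    { coeff     = coeff R
    ; support   = support R
    ; pivot     = pivot R
    ; nonzero   = nonzero R
    ; vanishing = λ { zero    → sum-zero (λ j → coeff R j * L zero j) term
                    ; (suc i) → vanishing R i }
    }
    where
    term : ∀ j → coeff R j * L zero j ≡ 0ℤ
    term j with j ∈? C
    ... | no j∉C  = cong (_* L zero j) (support R j j∉C)
    ... | yes j∈C = trans (cong (coeff R j *_) (L₀≡0 j j∈C)) (*-zeroʳ (coeff R j))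

  module Pivoting (L : Fin (suc m) → Vector n) (C : Subset n) (p : Fin n)
                  (p∈C : p ∈ C) (ℓp≢0 : L zero p ≢ 0ℤ) where

    ℓ : Vector n
    ℓ = L zero

    reduced : Fin m → Vector n
    reduced i j = ℓ p * L (suc i) j + - L (suc i) p * ℓ j

    lift-relation : Relation reduced (C ∖ p) → Relation L C
    lift-relation R = record
      { coeff     = c
      ; support   = λ j j∉C → trans (off j λ { refl → j∉C p∈C })
          (trans (cong (ℓ p *_) (support R j (j∉C ∘ ∈p∖i⇒∈p C p))) (*-zeroʳ (ℓ p)))
      ; pivot     = pivot R
      ; nonzero   = λ eq → *-nonZero ℓp≢0 (nonzero R) (trans (sym (off (pivot R) pivot≢p)) eq)
      ; vanishing = λ
        { zero    → trans (c∙ ℓ) (lemma (ℓ p) S)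
        ; (suc i) → trans (c∙ (L (suc i))) (trans (lemma′ (ℓ p) (c′ ∙ L (suc i)) S (L (suc i) p))
                      (trans (sym (∙-linʳ c′ (ℓ p) (L (suc i)) (- L (suc i) p) ℓ)) (vanishing R i)))
        }
      }
      where
      c′ : Vector n
      c′ = coeff R
      S : ℤ
      S = c′ ∙ ℓ
      -- Scaling by `ℓ p` replaces division by the pivot entry. As `c′` is zero at `p`, the entry of
      -- `c` there is `- S`, which is the value that solves the first equation.
      c : Vector n
      c j = ℓ p * c′ j + - S * δ p j
      pivot≢p : pivot R ≢ p
      pivot≢p eq = i∉p∖i C p (subst (_∈ C ∖ p) eq (pivot∈ R))
      lemma₀ : ∀ x S → x + - S * 0ℤ ≡ x
      lemma₀ = solve-∀
      off : ∀ j → j ≢ p → c j ≡ ℓ p * c′ j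
      off j j≢p = trans (cong (λ x → ℓ p * c′ j + - S * x) (δ-other p j j≢p))
        (lemma₀ (ℓ p * c′ j) S)
      c∙ : ∀ ℓ′ → c ∙ ℓ′ ≡ ℓ p * c′ ∙ ℓ′ + - S * ℓ′ p
      c∙ ℓ′ = trans (∙-linˡ (ℓ p) c′ (- S) (δ p) ℓ′)
        (cong (λ x → ℓ p * c′ ∙ ℓ′ + - S * x) (trans (∙-comm (δ p) ℓ′) (∙-δʳ ℓ′ p)))
      lemma : ∀ l S → l * S + - S * l ≡ 0ℤ
      lemma = solve-∀
      lemma′ : ∀ l x S y → l * x + - S * y ≡ l * x + - y * S
      lemma′ = solve-∀

  -- Each elimination uses up one equation and one unknown of `C`, so the strict inequality
  -- survives; dropping an equation only helps. Once no equation is left, any `p` in `C` gives the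
  -- solution `δ p`.
  nontrivial-relation : (L : Fin m → Vector n) (C : Subset n) → m < ∣ C ∣ → Relation L C
  nontrivial-relation {zero} L C h with p , p∈C ← ∣p∣>0⇒∃∈ C h = record
    { coeff     = δ p
    ; support   = λ j j∉C → δ-other p j λ { refl → j∉C p∈C }
    ; pivot     = p
    ; nonzero   = λ eq → contradiction (trans (sym (δ-same p)) eq) λ ()
    ; vanishing = λ ()
    }
  nontrivial-relation {suc m} L C h with Fin.any? (λ p → (p ∈? C) ×-dec ¬? (L zero p ≟ 0ℤ))
  ... | no ∄p =
    extend-relation L C (λ j j∈C → decidable-stable (L zero j ≟ 0ℤ) λ ne → ∄p (j , j∈C , ne))
      (nontrivial-relation (L ∘ suc) C (ℕ.<-trans (ℕ.n<1+n m) h))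
  ... | yes (p , p∈C , ℓp≢0) =
    lift-relation (nontrivial-relation reduced (C ∖ p) (ℕ.≤-pred (subst (suc m <_) (∣p∖i∣ p∈C) h)))
    where open Pivoting L C p p∈C ℓp≢0

  -- The exterior algebra

  -- An element of the exterior algebra of ℤ^M is given by its coefficients: s indexes
  -- the product, in increasing order, of the standard basis vectors e_i with i ∈ s.
  Λ : ℕ → Set
  Λ M = Subset M → ℤ

  -- α = e₀ ∧ hd α + tl α
  hd tl : Λ (suc M) → Λ M
  hd α s = α (inside ∷ s)
  tl α s = α (outside ∷ s)

  -- By computation `hd (v ⋀ α)` is `lin (v zero) (tl α) -1ℤ (v ∘ suc ⋀ hd α)`. Linearity is
  -- therefore stated for two-term combinations, the form in which the inductions over coordinates
  -- meet it.
  lin : ℤ → Λ M → ℤ → Λ M → Λ M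
  lin c α d β s = c * α s + d * β s

  infixr 8 _·_ _⋀_
  _·_ : ℤ → Λ M → Λ M
  (c · α) s = c * α s

  -- Left multiplication by a vector. The component of `v` along e₀ meets only `tl α`, because e₀ ∧
  -- e₀ = 0; the sign in the `inside` case comes from moving `v ∘ suc` past e₀.
  _⋀_ : Vector M → Λ M → Λ M
  (v ⋀ α) []            = 0ℤ
  (v ⋀ α) (inside ∷ s)  = v zero * tl α s + -1ℤ * (v ∘ suc ⋀ hd α) s
  (v ⋀ α) (outside ∷ s) = (v ∘ suc ⋀ tl α) s

  ⋀-cong : {v w : Vector M} {α β : Λ M} → v ≗ w → α ≗ β → v ⋀ α ≗ w ⋀ β
  ⋀-cong p q []            = refl
  ⋀-cong p q (inside ∷ s)  =
    cong₂ (λ x y → x + -1ℤ * y) (cong₂ _*_ (p zero) (q (outside ∷ s)))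
      (⋀-cong (p ∘ suc) (q ∘ (inside ∷_)) s)
  ⋀-cong p q (outside ∷ s) = ⋀-cong (p ∘ suc) (q ∘ (outside ∷_)) s

  ⋀-congʳ : (v : Vector M) {α β : Λ M} → α ≗ β → v ⋀ α ≗ v ⋀ β
  ⋀-congʳ v = ⋀-cong {v = v} (λ _ → refl)

  ⋀-lin : ∀ (v : Vector M) c α d β → v ⋀ lin c α d β ≗ lin c (v ⋀ α) d (v ⋀ β)
  ⋀-lin v c α d β [] = lemma c d
    where
    lemma : ∀ c d → 0ℤ ≡ c * 0ℤ + d * 0ℤ
    lemma = solve-∀
  ⋀-lin v c α d β (inside ∷ s)
    rewrite ⋀-lin (v ∘ suc) c (hd α) d (hd β) s =
    lemma (v zero) c (tl α s) ((v ∘ suc ⋀ hd α) s) d (tl β s) ((v ∘ suc ⋀ hd β) s)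
    where
    lemma : ∀ v c a a′ d b b′ → v * (c * a + d * b) + -1ℤ * (c * a′ + d * b′) ≡
            c * (v * a + -1ℤ * a′) + d * (v * b + -1ℤ * b′)
    lemma = solve-∀
  ⋀-lin v c α d β (outside ∷ s) = ⋀-lin (v ∘ suc) c (tl α) d (tl β) s

  ⋀-· : ∀ (v : Vector M) c α → v ⋀ (c · α) ≗ c · (v ⋀ α)
  ⋀-· v c α []            = sym (*-zeroʳ c)
  ⋀-· v c α (inside ∷ s) rewrite ⋀-· (v ∘ suc) c (hd α) s =
    lemma (v zero) c (tl α s) ((v ∘ suc ⋀ hd α) s)
    where
    lemma : ∀ v c a a′ → v * (c * a) + -1ℤ * (c * a′) ≡ c * (v * a + -1ℤ * a′)
    lemma = solve-∀
  ⋀-· v c α (outside ∷ s) = ⋀-· (v ∘ suc) c (tl α) s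

  ⋀-zeroʳ : (v : Vector M) → v ⋀ (λ _ → 0ℤ) ≗ λ _ → 0ℤ
  ⋀-zeroʳ v = ⋀-· v 0ℤ (λ _ → 0ℤ)

  ⋀-zeroˡ : (α : Λ M) → (λ _ → 0ℤ) ⋀ α ≗ λ _ → 0ℤ
  ⋀-zeroˡ α []            = refl
  ⋀-zeroˡ α (inside ∷ s) rewrite ⋀-zeroˡ (hd α) s = refl
  ⋀-zeroˡ α (outside ∷ s) = ⋀-zeroˡ (tl α) s

  ⋀-+ˡ : ∀ c (v w : Vector M) α s →
         ((λ r → c * v r + w r) ⋀ α) s ≡ c * (v ⋀ α) s + (w ⋀ α) s
  ⋀-+ˡ c v w α [] = lemma c
    where
    lemma : ∀ c → 0ℤ ≡ c * 0ℤ + 0ℤ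
    lemma = solve-∀
  ⋀-+ˡ c v w α (inside ∷ s) rewrite ⋀-+ˡ c (v ∘ suc) (w ∘ suc) (hd α) s =
    lemma c (v zero) (w zero) (tl α s) ((v ∘ suc ⋀ hd α) s) ((w ∘ suc ⋀ hd α) s)
    where
    lemma : ∀ c v w a x y → (c * v + w) * a + -1ℤ * (c * x + y) ≡
            c * (v * a + -1ℤ * x) + (w * a + -1ℤ * y)
    lemma = solve-∀
  ⋀-+ˡ c v w α (outside ∷ s) = ⋀-+ˡ c (v ∘ suc) (w ∘ suc) (tl α) s

  comb : Vector n → (Fin n → Vector M) → Vector M
  comb c V r = sum λ j → c j * V j r

  ⋀-comb : ∀ (c : Vector n) (V : Fin n → Vector M) α s →
           (comb c V ⋀ α) s ≡ sum λ j → c j * (V j ⋀ α) s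
  ⋀-comb {zero}  c V α s = ⋀-zeroˡ α s
  ⋀-comb {suc n} c V α s = trans (⋀-+ˡ (c zero) (V zero) (comb (c ∘ suc) (V ∘ suc)) α s)
    (cong (_+_ (c zero * (V zero ⋀ α) s)) (⋀-comb (c ∘ suc) (V ∘ suc) α s))

  -- With v = v₀e₀ + v′, the two mixed terms v₀ e₀ ∧ v′ ∧ `tl α` arise with opposite signs and
  -- cancel; what remains contains v′ ∧ v′.
  ⋀-square : (v : Vector M) (α : Λ M) → v ⋀ v ⋀ α ≗ λ _ → 0ℤ
  ⋀-square v α []            = refl
  ⋀-square v α (inside ∷ s)
    rewrite ⋀-lin (v ∘ suc) (v zero) (tl α) -1ℤ (v ∘ suc ⋀ hd α) s
          | ⋀-square (v ∘ suc) (hd α) s = lemma (v zero) ((v ∘ suc ⋀ tl α) s)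
    where
    lemma : ∀ v a → v * a + -1ℤ * (v * a + -1ℤ * 0ℤ) ≡ 0ℤ
    lemma = solve-∀
  ⋀-square v α (outside ∷ s) = ⋀-square (v ∘ suc) (tl α) s

  ⋀-anticomm : (v w : Vector M) (α : Λ M) → v ⋀ w ⋀ α ≗ -1ℤ · (w ⋀ v ⋀ α)
  ⋀-anticomm v w α []            = refl
  ⋀-anticomm v w α (inside ∷ s)
    rewrite ⋀-lin (v ∘ suc) (w zero) (tl α) -1ℤ (w ∘ suc ⋀ hd α) s
          | ⋀-lin (w ∘ suc) (v zero) (tl α) -1ℤ (v ∘ suc ⋀ hd α) s
          | ⋀-anticomm (v ∘ suc) (w ∘ suc) (hd α) s =
    lemma (v zero) (w zero) ((w ∘ suc ⋀ tl α) s) ((v ∘ suc ⋀ tl α) s)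
      ((w ∘ suc ⋀ v ∘ suc ⋀ hd α) s)
    where
    lemma : ∀ v w x y z → v * x + -1ℤ * (w * y + -1ℤ * (-1ℤ * z)) ≡
            -1ℤ * (w * y + -1ℤ * (v * x + -1ℤ * z))
    lemma = solve-∀
  ⋀-anticomm v w α (outside ∷ s) = ⋀-anticomm (v ∘ suc) (w ∘ suc) (tl α) s

  -- Grade involution and pairing into the volume form

  σ : Subset M → ℤ
  σ []            = 1ℤ
  σ (inside ∷ s)  = -1ℤ * σ s
  σ (outside ∷ s) = σ s

  -- The grade involution: α ∧ v = v ∧ ε α for every vector v.
  ε : Λ M → Λ M
  ε α s = σ s * α s

  σ-square : (s : Subset M) → σ s * σ s ≡ 1ℤ
  σ-square []            = refl
  σ-square (inside ∷ s)  = trans (lemma (σ s)) (σ-square s)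
    where
    lemma : ∀ x → (-1ℤ * x) * (-1ℤ * x) ≡ x * x
    lemma = solve-∀
  σ-square (outside ∷ s) = σ-square s

  ε-involutive : (α : Λ M) → ε (ε α) ≗ α
  ε-involutive α s = begin
    σ s * (σ s * α s) ≡⟨ *-assoc (σ s) (σ s) (α s) ⟨
    (σ s * σ s) * α s ≡⟨ cong (_* α s) (σ-square s) ⟩
    1ℤ * α s          ≡⟨ *-identityˡ (α s) ⟩
    α s               ∎

  hd-ε : (α : Λ (suc M)) → hd (ε α) ≗ -1ℤ · ε (hd α)
  hd-ε α s = *-assoc -1ℤ (σ s) (hd α s)

  -- A factor `v` raises every degree by one, which reverses every sign of `ε`.
  ε-⋀ : (v : Vector M) (α : Λ M) → ε (v ⋀ α) ≗ -1ℤ · (v ⋀ ε α)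
  ε-⋀ v α []            = refl
  ε-⋀ v α (inside ∷ s)  = begin
    -1ℤ * σ s * (v zero * tl α s + -1ℤ * (v ∘ suc ⋀ hd α) s)
      ≡⟨ lemma (σ s) (v zero) (tl α s) _ ⟩
    -1ℤ * (v zero * (σ s * tl α s)) + σ s * (v ∘ suc ⋀ hd α) s
      ≡⟨ cong (_+_ (-1ℤ * (v zero * (σ s * tl α s))))
           (trans (ε-⋀ (v ∘ suc) (hd α) s) (sym eq)) ⟩
    -1ℤ * (v zero * (σ s * tl α s)) + (v ∘ suc ⋀ hd (ε α)) s
      ≡⟨ lemma′ (v zero * (σ s * tl α s)) ((v ∘ suc ⋀ hd (ε α)) s) ⟩
    -1ℤ * (v zero * (σ s * tl α s) + -1ℤ * (v ∘ suc ⋀ hd (ε α)) s) ∎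
    where
    lemma : ∀ σ v a x → -1ℤ * σ * (v * a + -1ℤ * x) ≡ -1ℤ * (v * (σ * a)) + σ * x
    lemma = solve-∀
    lemma′ : ∀ x y → -1ℤ * x + y ≡ -1ℤ * (x + -1ℤ * y)
    lemma′ = solve-∀
    eq : (v ∘ suc ⋀ hd (ε α)) s ≡ -1ℤ * (v ∘ suc ⋀ ε (hd α)) s
    eq = trans (⋀-congʳ (v ∘ suc) (hd-ε α) s) (⋀-· (v ∘ suc) -1ℤ (ε (hd α)) s)
  ε-⋀ v α (outside ∷ s) = ε-⋀ (v ∘ suc) (tl α) s

  -- ⟪ α , β ⟫ is the coefficient of the volume form in α ∧ β.
  ⟪_,_⟫ : Λ M → Λ M → ℤ
  ⟪_,_⟫ {zero}  α β = α [] * β []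
  ⟪_,_⟫ {suc M} α β = ⟪ hd α , tl β ⟫ + ⟪ ε (tl α) , hd β ⟫

  ⟪⟫-cong : {α α′ β β′ : Λ M} → α ≗ α′ → β ≗ β′ → ⟪ α , β ⟫ ≡ ⟪ α′ , β′ ⟫
  ⟪⟫-cong {zero}  p q = cong₂ _*_ (p []) (q [])
  ⟪⟫-cong {suc M} p q = cong₂ _+_
    (⟪⟫-cong (p ∘ (inside ∷_)) (q ∘ (outside ∷_)))
    (⟪⟫-cong (λ s → cong (σ s *_) (p (outside ∷ s))) (q ∘ (inside ∷_)))

  ⟪⟫-congˡ : ∀ {α α′ : Λ M} β → α ≗ α′ → ⟪ α , β ⟫ ≡ ⟪ α′ , β ⟫
  ⟪⟫-congˡ β p = ⟪⟫-cong {β = β} p (λ _ → refl)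

  ⟪⟫-congʳ : ∀ (α : Λ M) {β β′} → β ≗ β′ → ⟪ α , β ⟫ ≡ ⟪ α , β′ ⟫
  ⟪⟫-congʳ α q = ⟪⟫-cong {α = α} (λ _ → refl) q

  ⟪⟫-linˡ : ∀ c (α : Λ M) d α′ β → ⟪ lin c α d α′ , β ⟫ ≡ c * ⟪ α , β ⟫ + d * ⟪ α′ , β ⟫
  ⟪⟫-linˡ {zero}  c α d α′ β = lemma c (α []) d (α′ []) (β [])
    where
    lemma : ∀ c a d b x → (c * a + d * b) * x ≡ c * (a * x) + d * (b * x)
    lemma = solve-∀
  ⟪⟫-linˡ {suc M} c α d α′ β = begin
    ⟪ lin c (hd α) d (hd α′) , tl β ⟫ + ⟪ ε (lin c (tl α) d (tl α′)) , hd β ⟫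
      ≡⟨ cong (_+_ (⟪ lin c (hd α) d (hd α′) , tl β ⟫))
           (⟪⟫-congˡ (hd β) λ s → lemma (σ s) c (tl α s) d (tl α′ s)) ⟩
    ⟪ lin c (hd α) d (hd α′) , tl β ⟫ + ⟪ lin c (ε (tl α)) d (ε (tl α′)) , hd β ⟫
      ≡⟨ cong₂ _+_ (⟪⟫-linˡ c (hd α) d (hd α′) (tl β)) (⟪⟫-linˡ c (ε (tl α)) d (ε (tl α′)) (hd β)) ⟩
    (c * ⟪ hd α , tl β ⟫ + d * ⟪ hd α′ , tl β ⟫) + (c * ⟪ ε (tl α) , hd β ⟫ + d * ⟪ ε (tl α′) , hd β ⟫)
      ≡⟨ lemma′ c d ⟪ hd α , tl β ⟫ ⟪ hd α′ , tl β ⟫ ⟪ ε (tl α) , hd β ⟫ ⟪ ε (tl α′) , hd β ⟫ ⟩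
    c * ⟪ α , β ⟫ + d * ⟪ α′ , β ⟫ ∎
    where
    lemma : ∀ σ c a d b → σ * (c * a + d * b) ≡ c * (σ * a) + d * (σ * b)
    lemma = solve-∀
    lemma′ : ∀ c d w x y z → (c * w + d * x) + (c * y + d * z) ≡ c * (w + y) + d * (x + z)
    lemma′ = solve-∀

  ⟪⟫-linʳ : ∀ (α : Λ M) c β d β′ → ⟪ α , lin c β d β′ ⟫ ≡ c * ⟪ α , β ⟫ + d * ⟪ α , β′ ⟫
  ⟪⟫-linʳ {zero}  α c β d β′ = lemma c (β []) d (β′ []) (α [])
    where
    lemma : ∀ c a d b x → x * (c * a + d * b) ≡ c * (x * a) + d * (x * b)
    lemma = solve-∀
  ⟪⟫-linʳ {suc M} α c β d β′ = begin
    ⟪ hd α , lin c (tl β) d (tl β′) ⟫ + ⟪ ε (tl α) , lin c (hd β) d (hd β′) ⟫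
      ≡⟨ cong₂ _+_ (⟪⟫-linʳ (hd α) c (tl β) d (tl β′)) (⟪⟫-linʳ (ε (tl α)) c (hd β) d (hd β′)) ⟩
    (c * ⟪ hd α , tl β ⟫ + d * ⟪ hd α , tl β′ ⟫) + (c * ⟪ ε (tl α) , hd β ⟫ + d * ⟪ ε (tl α) , hd β′ ⟫)
      ≡⟨ lemma′ c d ⟪ hd α , tl β ⟫ ⟪ hd α , tl β′ ⟫ ⟪ ε (tl α) , hd β ⟫ ⟪ ε (tl α) , hd β′ ⟫ ⟩
    c * ⟪ α , β ⟫ + d * ⟪ α , β′ ⟫ ∎
    where
    lemma′ : ∀ c d w x y z → (c * w + d * x) + (c * y + d * z) ≡ c * (w + y) + d * (x + z)
    lemma′ = solve-∀

  ⟪⟫-·ˡ : ∀ c (α β : Λ M) → ⟪ c · α , β ⟫ ≡ c * ⟪ α , β ⟫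
  ⟪⟫-·ˡ c α β = begin
    ⟪ c · α , β ⟫                     ≡⟨ ⟪⟫-congˡ β (λ s → sym (+-identityʳ _)) ⟩
    ⟪ lin c α 0ℤ α , β ⟫              ≡⟨ ⟪⟫-linˡ c α 0ℤ α β ⟩
    c * ⟪ α , β ⟫ + 0ℤ * ⟪ α , β ⟫    ≡⟨ +-identityʳ _ ⟩
    c * ⟪ α , β ⟫                     ∎

  ⟪⟫-·ʳ : ∀ (α : Λ M) c β → ⟪ α , c · β ⟫ ≡ c * ⟪ α , β ⟫
  ⟪⟫-·ʳ α c β = begin
    ⟪ α , c · β ⟫                     ≡⟨ ⟪⟫-congʳ α (λ s → sym (+-identityʳ _)) ⟩
    ⟪ α , lin c β 0ℤ β ⟫              ≡⟨ ⟪⟫-linʳ α c β 0ℤ β ⟩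
    c * ⟪ α , β ⟫ + 0ℤ * ⟪ α , β ⟫    ≡⟨ +-identityʳ _ ⟩
    c * ⟪ α , β ⟫                     ∎

  ⟪⟫-zeroʳ : (α : Λ M) → ⟪ α , (λ _ → 0ℤ) ⟫ ≡ 0ℤ
  ⟪⟫-zeroʳ α = ⟪⟫-·ʳ α 0ℤ (λ _ → 0ℤ)

  ⟪⟫-sumʳ : ∀ (α : Λ M) (c : Vector n) (β : Fin n → Λ M) →
            ⟪ α , (λ s → sum λ j → c j * β j s) ⟫ ≡ sum λ j → c j * ⟪ α , β j ⟫
  ⟪⟫-sumʳ {n = zero}  α c β = ⟪⟫-zeroʳ α
  ⟪⟫-sumʳ {n = suc n} α c β = begin
    ⟪ α , (λ s → c zero * β zero s + rest s) ⟫
      ≡⟨ ⟪⟫-congʳ α (λ s → cong (_+_ (c zero * β zero s)) (sym (*-identityˡ (rest s)))) ⟩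
    ⟪ α , lin (c zero) (β zero) 1ℤ rest ⟫
      ≡⟨ ⟪⟫-linʳ α (c zero) (β zero) 1ℤ rest ⟩
    c zero * ⟪ α , β zero ⟫ + 1ℤ * ⟪ α , rest ⟫
      ≡⟨ cong (_+_ (c zero * ⟪ α , β zero ⟫))
           (trans (*-identityˡ _) (⟪⟫-sumʳ α (c ∘ suc) (β ∘ suc))) ⟩
    _ ∎
    where
    rest : Λ _
    rest s = sum λ j → c (suc j) * β (suc j) s

  -- Since v ∧ α = ε α ∧ v, the vector can move from the left argument to the right one. The
  -- induction hypothesis is used at `hd α` and at `ε (tl α)`; the latter produces a double `ε`,
  -- which cancels.
  ⟪⟫-⋀ : (v : Vector M) (α β : Λ M) → ⟪ v ⋀ α , β ⟫ ≡ ⟪ ε α , v ⋀ β ⟫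
  ⟪⟫-⋀ {zero}  v α β = sym (*-zeroʳ (ε α []))
  ⟪⟫-⋀ {suc M} v α β = begin
    ⟪ lin v₀ α₀ -1ℤ (v′ ⋀ α₁) , β₀ ⟫ + ⟪ ε (v′ ⋀ α₀) , β₁ ⟫
      ≡⟨ cong₂ _+_ (⟪⟫-linˡ v₀ α₀ -1ℤ (v′ ⋀ α₁) β₀)
           (trans (⟪⟫-congˡ β₁ (ε-⋀ v′ α₀)) (⟪⟫-·ˡ -1ℤ (v′ ⋀ ε α₀) β₁)) ⟩
    v₀ * ⟪ α₀ , β₀ ⟫ + -1ℤ * ⟪ v′ ⋀ α₁ , β₀ ⟫ + -1ℤ * ⟪ v′ ⋀ ε α₀ , β₁ ⟫
      ≡⟨ cong₂ (λ x y → v₀ * ⟪ α₀ , β₀ ⟫ + -1ℤ * x + -1ℤ * y)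
           (⟪⟫-⋀ v′ α₁ β₀)
           (trans (⟪⟫-⋀ v′ (ε α₀) β₁) (⟪⟫-congˡ (v′ ⋀ β₁) (ε-involutive α₀))) ⟩
    v₀ * ⟪ α₀ , β₀ ⟫ + -1ℤ * ⟪ ε α₁ , v′ ⋀ β₀ ⟫ + -1ℤ * ⟪ α₀ , v′ ⋀ β₁ ⟫
      ≡⟨ lemma (v₀ * ⟪ α₀ , β₀ ⟫) ⟪ ε α₁ , v′ ⋀ β₀ ⟫ ⟪ α₀ , v′ ⋀ β₁ ⟫ ⟩
    -1ℤ * ⟪ ε α₁ , v′ ⋀ β₀ ⟫ + (v₀ * ⟪ α₀ , β₀ ⟫ + -1ℤ * ⟪ α₀ , v′ ⋀ β₁ ⟫)
      ≡⟨ cong₂ _+_ (sym (trans (⟪⟫-congˡ (v′ ⋀ β₀) (hd-ε α)) (⟪⟫-·ˡ -1ℤ (ε α₁) (v′ ⋀ β₀))))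
           (sym (trans (⟪⟫-congˡ (lin v₀ β₀ -1ℤ (v′ ⋀ β₁)) (ε-involutive α₀))
             (⟪⟫-linʳ α₀ v₀ β₀ -1ℤ (v′ ⋀ β₁)))) ⟩
    ⟪ hd (ε α) , v′ ⋀ β₀ ⟫ + ⟪ ε (ε α₀) , lin v₀ β₀ -1ℤ (v′ ⋀ β₁) ⟫ ∎
    where
    v₀ = v zero
    v′ = v ∘ suc
    α₁ = hd α
    α₀ = tl α
    β₁ = hd β
    β₀ = tl β
    lemma : ∀ x y z → x + -1ℤ * y + -1ℤ * z ≡ -1ℤ * y + (x + -1ℤ * z)
    lemma = solve-∀

  -- Moved across the pairing, the left copy of `v` lands next to the right copy, and v ∧ v = 0.
  ⟪⟫-common-factor : (v : Vector M) (α β : Λ M) → ⟪ v ⋀ α , v ⋀ β ⟫ ≡ 0ℤ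
  ⟪⟫-common-factor v α β = begin
    ⟪ v ⋀ α , v ⋀ β ⟫       ≡⟨ ⟪⟫-⋀ v α (v ⋀ β) ⟩
    ⟪ ε α , v ⋀ v ⋀ β ⟫     ≡⟨ ⟪⟫-congʳ (ε α) (⋀-square v β) ⟩
    ⟪ ε α , (λ _ → 0ℤ) ⟫    ≡⟨ ⟪⟫-zeroʳ (ε α) ⟩
    0ℤ                      ∎

  -- Basis monomials and products of the vectors of a subset

  bas : Subset M → Λ M
  bas []            []            = 1ℤ
  bas (inside ∷ I)  (inside ∷ s)  = bas I s
  bas (outside ∷ I) (outside ∷ s) = bas I s
  bas (inside ∷ I)  (outside ∷ s) = 0ℤ
  bas (outside ∷ I) (inside ∷ s)  = 0ℤ

  -- `bas ⊥` is the unit of the exterior algebra and serves as the empty product.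
  ω : (Fin n → Vector M) → Subset n → Λ M
  ω V []            = bas ⊥
  ω V (inside ∷ A)  = V zero ⋀ ω (V ∘ suc) A
  ω V (outside ∷ A) = ω (V ∘ suc) A

  -- Anticommutation moves the factor at `p` to the front past the earlier factors. The scalar is a
  -- sign, left unspecified because the vanishing of the pairing requires only that it exists.
  ω-extract : (V : Fin n → Vector M) {A : Subset n} {p : Fin n} → p ∈ A →
              ∃ λ a → ω V A ≗ a · (V p ⋀ ω V (A ∖ p))
  ω-extract V here = 1ℤ , λ s → sym (*-identityˡ _)
  ω-extract V {outside ∷ A} (there p∈A) = ω-extract (V ∘ suc) p∈A
  ω-extract V {inside ∷ A} {suc p} (there p∈A) with a , eq ← ω-extract (V ∘ suc) p∈A =
    - a , λ s → begin
      (v₀ ⋀ ω (V ∘ suc) A) s         ≡⟨ ⋀-congʳ v₀ eq s ⟩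
      (v₀ ⋀ (a · (vp ⋀ rest))) s     ≡⟨ ⋀-· v₀ a (vp ⋀ rest) s ⟩
      a * (v₀ ⋀ vp ⋀ rest) s         ≡⟨ cong (a *_) (⋀-anticomm v₀ vp rest s) ⟩
      a * (-1ℤ * (vp ⋀ v₀ ⋀ rest) s) ≡⟨ lemma a ((vp ⋀ v₀ ⋀ rest) s) ⟩
      - a * (vp ⋀ v₀ ⋀ rest) s       ∎
    where
    v₀ = V zero
    vp = V (suc p)
    rest = ω (V ∘ suc) (A ∖ p)
    lemma : ∀ a x → a * (-1ℤ * x) ≡ - a * x
    lemma = solve-∀

  ⋀-ω-absorb : (V : Fin n → Vector M) {A : Subset n} {p : Fin n} → p ∈ A →
               V p ⋀ ω V A ≗ λ _ → 0ℤ
  ⋀-ω-absorb V {A} {p} p∈A s with a , eq ← ω-extract V p∈A = begin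
    (V p ⋀ ω V A) s                       ≡⟨ ⋀-congʳ (V p) eq s ⟩
    (V p ⋀ (a · (V p ⋀ ω V (A ∖ p)))) s   ≡⟨ ⋀-· (V p) a (V p ⋀ ω V (A ∖ p)) s ⟩
    a * (V p ⋀ V p ⋀ ω V (A ∖ p)) s       ≡⟨ cong (a *_) (⋀-square (V p) (ω V (A ∖ p)) s) ⟩
    a * 0ℤ                                ≡⟨ *-zeroʳ a ⟩
    0ℤ                                    ∎

  -- Replacing the factor V p of ω V A by Σ c_j V j multiplies ω V A by c p, the other
  -- summands being absorbed by the remaining factors.
  ω-exchange : (V : Fin n → Vector M) {A : Subset n} {p : Fin n} (c : Vector n) → p ∈ A →
               (∀ j → j ∉ A → c j ≡ 0ℤ) →
               ∃ λ a → c p · ω V A ≗ a · (comb c V ⋀ ω V (A ∖ p))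
  ω-exchange V {A} {p} c p∈A supp with a , eq ← ω-extract V p∈A = a , λ s → begin
    c p * ω V A s                          ≡⟨ cong (c p *_) (eq s) ⟩
    c p * (a * (V p ⋀ rest) s)             ≡⟨ lemma (c p) a ((V p ⋀ rest) s) ⟩
    a * (c p * (V p ⋀ rest) s)             ≡⟨ cong (a *_) (sym (sum-single (λ j → c j * (V j ⋀ rest) s) p (other s))) ⟩
    a * sum (λ j → c j * (V j ⋀ rest) s)   ≡⟨ cong (a *_) (sym (⋀-comb c V rest s)) ⟩
    a * (comb c V ⋀ rest) s                ∎
    where
    rest = ω V (A ∖ p)
    lemma : ∀ c a x → c * (a * x) ≡ a * (c * x)
    lemma = solve-∀
    other : ∀ s j → j ≢ p → c j * (V j ⋀ rest) s ≡ 0ℤ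
    other s j j≢p with j ∈? A
    ... | no j∉A  = cong (_* (V j ⋀ rest) s) (supp j j∉A)
    ... | yes j∈A = trans (cong (c j *_) (⋀-ω-absorb V (∈p⇒∈p∖i A p j≢p j∈A) s)) (*-zeroʳ (c j))

  -- The coefficient of e₀ ∧ ⋯ ∧ e_{t-1}, an element of the exterior algebra of the last N coordinates.
  top : ∀ t → Λ (t ℕ.+ N) → Λ N
  top zero    α = α
  top (suc t) α = top t (hd α)

  top-cong : ∀ t {α β : Λ (t ℕ.+ N)} → α ≗ β → top t α ≗ top t β
  top-cong zero    eq = eq
  top-cong (suc t) eq = top-cong t (eq ∘ (inside ∷_))

  top-· : ∀ t c (α : Λ (t ℕ.+ N)) → top t (c · α) ≗ c · top t α
  top-· zero    c α s = refl
  top-· (suc t) c α = top-· t c (hd α)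

  -- Having no component along the first `t` basis vectors, `v` cannot contribute to e₀ ∧ ⋯ ∧
  -- e_{t-1}; it only has to pass these factors, each at the cost of a sign.
  top-⋀ : ∀ t (v : Vector (t ℕ.+ N)) → (∀ i → v (i ↑ˡ N) ≡ 0ℤ) → (α : Λ (t ℕ.+ N)) →
          ∃ λ a → top t (v ⋀ α) ≗ a · (v ∘ (t ↑ʳ_) ⋀ top t α)
  top-⋀ zero    v v≡0 α = 1ℤ , λ s → sym (*-identityˡ ((v ⋀ α) s))
  top-⋀ (suc t) v v≡0 α with a , eq ← top-⋀ t (v ∘ suc) (v≡0 ∘ suc) (hd α) =
    -1ℤ * a , λ s → begin
      top t (hd (v ⋀ α)) s                  ≡⟨ top-cong t eq₀ s ⟩
      top t (-1ℤ · (v ∘ suc ⋀ hd α)) s      ≡⟨ top-· t -1ℤ (v ∘ suc ⋀ hd α) s ⟩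
      -1ℤ * top t (v ∘ suc ⋀ hd α) s        ≡⟨ cong (-1ℤ *_) (eq s) ⟩
      -1ℤ * (a * x s)                       ≡⟨ sym (*-assoc -1ℤ a (x s)) ⟩
      -1ℤ * a * x s                         ∎
    where
    x = v ∘ (suc t ↑ʳ_) ⋀ top t (hd α)
    eq₀ : hd (v ⋀ α) ≗ -1ℤ · (v ∘ suc ⋀ hd α)
    eq₀ s = trans (cong (λ y → y * tl α s + -1ℤ * (v ∘ suc ⋀ hd α) s) (v≡0 zero))
              (+-identityˡ (-1ℤ * (v ∘ suc ⋀ hd α) s))

  -- The Füredi pairing

  Φ : ∀ t → (Fin n → Vector (t ℕ.+ N)) → Subset n → Subset n → ℤ
  Φ t V A B = ⟪ top t (ω V A) , top t (ω V B) ⟫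

  -- Some nontrivial combination x of the vectors V j, j ∈ A ∩ B, has its first t coordinates
  -- zero; up to scalars, x is then a factor of both arguments of the pairing.
  Φ-vanishes : ∀ t (V : Fin n → Vector (t ℕ.+ N)) (A B : Subset n) →
               t < ∣ A ∩ B ∣ → Φ t V A B ≡ 0ℤ
  Φ-vanishes {N = N} t V A B h =
    *-cancel-zero (nonzero R) (*-cancel-zero (nonzero R) (begin
      cp * (cp * Φ t V A B)
        ≡⟨ cong (cp *_) (sym (⟪⟫-·ʳ (top t (ω V A)) cp (top t (ω V B)))) ⟩
      cp * ⟪ top t (ω V A) , cp · top t (ω V B) ⟫
        ≡⟨ sym (⟪⟫-·ˡ cp (top t (ω V A)) (cp · top t (ω V B))) ⟩
      ⟪ cp · top t (ω V A) , cp · top t (ω V B) ⟫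
        ≡⟨ ⟪⟫-cong (factor p∈A suppA .proj₂) (factor p∈B suppB .proj₂) ⟩
      ⟪ a · (x′ ⋀ top t (ω V (A ∖ p))) , b · (x′ ⋀ top t (ω V (B ∖ p))) ⟫
        ≡⟨ ⟪⟫-·ˡ a (x′ ⋀ top t (ω V (A ∖ p))) (b · (x′ ⋀ top t (ω V (B ∖ p)))) ⟩
      a * ⟪ x′ ⋀ top t (ω V (A ∖ p)) , b · (x′ ⋀ top t (ω V (B ∖ p))) ⟫
        ≡⟨ cong (a *_) (⟪⟫-·ʳ (x′ ⋀ top t (ω V (A ∖ p))) b (x′ ⋀ top t (ω V (B ∖ p)))) ⟩
      a * (b * ⟪ x′ ⋀ top t (ω V (A ∖ p)) , x′ ⋀ top t (ω V (B ∖ p)) ⟫)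
        ≡⟨ cong (λ y → a * (b * y)) (⟪⟫-common-factor x′ (top t (ω V (A ∖ p))) (top t (ω V (B ∖ p)))) ⟩
      a * (b * 0ℤ)
        ≡⟨ trans (cong (a *_) (*-zeroʳ b)) (*-zeroʳ a) ⟩
      0ℤ ∎))
    where
    R = nontrivial-relation (λ i j → V j (i ↑ˡ N)) (A ∩ B) h
    p = pivot R
    cp = coeff R p
    x = comb (coeff R) V
    x′ = x ∘ (t ↑ʳ_)
    x≡0 : ∀ i → x (i ↑ˡ N) ≡ 0ℤ
    x≡0 = vanishing R
    p∈A = proj₁ (x∈p∩q⁻ A B (pivot∈ R))
    p∈B = proj₂ (x∈p∩q⁻ A B (pivot∈ R))
    suppA : ∀ j → j ∉ A → coeff R j ≡ 0ℤ
    suppA j j∉A = support R j (j∉A ∘ proj₁ ∘ x∈p∩q⁻ A B)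
    suppB : ∀ j → j ∉ B → coeff R j ≡ 0ℤ
    suppB j j∉B = support R j (j∉B ∘ proj₂ ∘ x∈p∩q⁻ A B)
    factor : ∀ {D} → p ∈ D → (∀ j → j ∉ D → coeff R j ≡ 0ℤ) →
             ∃ λ a → cp · top t (ω V D) ≗ a · (x′ ⋀ top t (ω V (D ∖ p)))
    factor {D} p∈D supp
      with a , eq ← ω-exchange V (coeff R) p∈D supp
         | b , eq′ ← top-⋀ t x x≡0 (ω V (D ∖ p)) = a * b , λ s → begin
      cp * top t (ω V D) s                       ≡⟨ sym (top-· t cp (ω V D) s) ⟩
      top t (cp · ω V D) s                       ≡⟨ top-cong t eq s ⟩
      top t (a · (x ⋀ ω V (D ∖ p))) s            ≡⟨ top-· t a (x ⋀ ω V (D ∖ p)) s ⟩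
      a * top t (x ⋀ ω V (D ∖ p)) s              ≡⟨ cong (a *_) (eq′ s) ⟩
      a * (b * (x′ ⋀ top t (ω V (D ∖ p))) s)     ≡⟨ sym (*-assoc a b _) ⟩
      a * b * (x′ ⋀ top t (ω V (D ∖ p))) s       ∎
    a = factor p∈A suppA .proj₁
    b = factor p∈B suppB .proj₁

  -- Degrees

  HasDegree : ℕ → Λ M → Set
  HasDegree d α = ∀ s → ∣ s ∣ ≢ d → α s ≡ 0ℤ

  ⋀-degree : (v : Vector M) {α : Λ M} → HasDegree d α → HasDegree (suc d) (v ⋀ α)
  ⋀-degree v h []            _  = refl
  ⋀-degree {d = d} v {α} h (inside ∷ s) ne = begin
    v zero * tl α s + -1ℤ * (v ∘ suc ⋀ hd α) s
      ≡⟨ cong₂ (λ x y → v zero * x + -1ℤ * y) (h (outside ∷ s) (ne ∘ cong suc)) (head-zero d h ne) ⟩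
    v zero * 0ℤ + -1ℤ * 0ℤ ≡⟨ cong (_+ 0ℤ) (*-zeroʳ (v zero)) ⟩
    0ℤ ∎
    where
    -- Degree 0 is a separate case: no degree lies below it, and `hd α` is then identically zero.
    head-zero : ∀ d → HasDegree d α → suc ∣ s ∣ ≢ suc d → (v ∘ suc ⋀ hd α) s ≡ 0ℤ
    head-zero zero    h ne = trans (⋀-congʳ (v ∘ suc) (λ s′ → h (inside ∷ s′) λ ()) s) (⋀-zeroʳ (v ∘ suc) s)
    head-zero (suc d) h ne =
      ⋀-degree (v ∘ suc) (λ s′ ne′ → h (inside ∷ s′) (ne′ ∘ ℕ.suc-injective)) s (ne ∘ cong suc)
  ⋀-degree v h (outside ∷ s) ne = ⋀-degree (v ∘ suc) (λ s′ → h (outside ∷ s′)) s ne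

  bas-⊥-degree : HasDegree {M} 0 (bas ⊥)
  bas-⊥-degree []            ne = contradiction refl ne
  bas-⊥-degree (inside ∷ s)  ne = refl
  bas-⊥-degree (outside ∷ s) ne = bas-⊥-degree s ne

  ω-degree : (V : Fin n → Vector M) (A : Subset n) → HasDegree ∣ A ∣ (ω V A)
  ω-degree V []            = bas-⊥-degree
  ω-degree V (inside ∷ A)  = ⋀-degree (V zero) (ω-degree (V ∘ suc) A)
  ω-degree V (outside ∷ A) = ω-degree (V ∘ suc) A

  top-degree : ∀ t {α : Λ (t ℕ.+ N)} → HasDegree (t ℕ.+ d) α → HasDegree d (top t α)
  top-degree zero    h = h
  top-degree (suc t) h = top-degree t λ s ne → h (inside ∷ s) (ne ∘ ℕ.suc-injective)


  -- Vectors with nonzero pairing for one given pair of sets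

  ε-bas : (I : Subset M) → ε (bas I) ≗ σ I · bas I
  ε-bas []            []            = refl
  ε-bas (inside ∷ I)  (inside ∷ s)  = begin
    -1ℤ * σ s * bas I s   ≡⟨ *-assoc -1ℤ (σ s) (bas I s) ⟩
    -1ℤ * (σ s * bas I s) ≡⟨ cong (-1ℤ *_) (ε-bas I s) ⟩
    -1ℤ * (σ I * bas I s) ≡⟨ sym (*-assoc -1ℤ (σ I) (bas I s)) ⟩
    -1ℤ * σ I * bas I s   ∎
  ε-bas (inside ∷ I)  (outside ∷ s) = trans (*-zeroʳ (σ s)) (sym (*-zeroʳ (-1ℤ * σ I)))
  ε-bas (outside ∷ I) (inside ∷ s)  = trans (*-zeroʳ (-1ℤ * σ s)) (sym (*-zeroʳ (σ I)))
  ε-bas (outside ∷ I) (outside ∷ s) = ε-bas I s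

  σ≢0 : (s : Subset M) → σ s ≢ 0ℤ
  σ≢0 s eq = contradiction (trans (sym (σ-square s)) (cong (_* σ s) eq)) λ ()

  -- Each coordinate lies in exactly one of the two index sets, so one summand of the pairing has a
  -- zero argument. The other is the pairing for the remaining coordinates, multiplied by the unit
  -- `σ I` when `ε` has acted.
  ⟪bas,bas∁⟫≢0 : (I : Subset M) → ⟪ bas I , bas (∁ I) ⟫ ≢ 0ℤ
  ⟪bas,bas∁⟫≢0 [] ()
  ⟪bas,bas∁⟫≢0 (inside ∷ I) eq = ⟪bas,bas∁⟫≢0 I (begin
    ⟪ bas I , bas (∁ I) ⟫      ≡⟨ sym (+-identityʳ ⟪ bas I , bas (∁ I) ⟫) ⟩
    ⟪ bas I , bas (∁ I) ⟫ + 0ℤ ≡⟨ cong (_+_ ⟪ bas I , bas (∁ I) ⟫) (sym (⟪⟫-zeroʳ (ε (tl (bas (inside ∷ I)))))) ⟩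
    ⟪ bas (inside ∷ I) , bas (∁ (inside ∷ I)) ⟫ ≡⟨ eq ⟩
    0ℤ ∎)
  ⟪bas,bas∁⟫≢0 (outside ∷ I) eq = *-nonZero (σ≢0 I) (⟪bas,bas∁⟫≢0 I) (begin
    σ I * ⟪ bas I , bas (∁ I) ⟫    ≡⟨ sym (⟪⟫-·ˡ (σ I) (bas I) (bas (∁ I))) ⟩
    ⟪ σ I · bas I , bas (∁ I) ⟫    ≡⟨ ⟪⟫-congˡ (bas (∁ I)) (λ s → sym (ε-bas I s)) ⟩
    ⟪ ε (bas I) , bas (∁ I) ⟫      ≡⟨ sym (+-identityˡ ⟪ ε (bas I) , bas (∁ I) ⟫) ⟩
    0ℤ + ⟪ ε (bas I) , bas (∁ I) ⟫ ≡⟨ cong (_+ ⟪ ε (bas I) , bas (∁ I) ⟫) (sym (⟪⟫-zeroʳ (hd (bas (outside ∷ I))))) ⟩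
    ⟪ bas (outside ∷ I) , bas (∁ (outside ∷ I)) ⟫ ≡⟨ eq ⟩
    0ℤ ∎)

  infix 4 _∝_
  -- Only nonvanishing is at stake from here on, so signs are absorbed into an unspecified nonzero
  -- scalar.
  _∝_ : Λ M → Λ M → Set
  α ∝ β = ∃ λ a → a ≢ 0ℤ × α ≗ a · β

  -- To reach its place the factor e_i passes the smaller elements of `I`, each contributing a
  -- factor -1.
  δ⋀bas : {I : Subset M} {i : Fin M} → i ∈ I → δ i ⋀ bas (I ∖ i) ∝ bas I
  δ⋀bas {I = inside ∷ I} here = 1ℤ , (λ ()) , λ
    { (inside ∷ s)  → trans (cong (λ x → 1ℤ * bas I s + -1ℤ * x) (⋀-zeroˡ (λ _ → 0ℤ) s)) (+-identityʳ (1ℤ * bas I s))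
    ; (outside ∷ s) → ⋀-zeroˡ (bas I) s }
  δ⋀bas {I = inside ∷ I} {suc i} (there i∈I) with a , a≢0 , eq ← δ⋀bas i∈I =
    -1ℤ * a , *-nonZero { -1ℤ} (λ ()) a≢0 , λ
    { (inside ∷ s)  → trans (+-identityˡ (-1ℤ * (δ i ⋀ bas (I ∖ i)) s))
                        (trans (cong (-1ℤ *_) (eq s)) (sym (*-assoc -1ℤ a (bas I s))))
    ; (outside ∷ s) → trans (⋀-zeroʳ (δ i) s) (sym (*-zeroʳ (-1ℤ * a))) }
  δ⋀bas {I = outside ∷ I} {suc i} (there i∈I) with a , a≢0 , eq ← δ⋀bas i∈I =
    a , a≢0 , λ
    { (inside ∷ s)  → trans (+-identityˡ (-1ℤ * (δ i ⋀ (λ _ → 0ℤ)) s))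
                        (trans (cong (-1ℤ *_) (⋀-zeroʳ (δ i) s)) (sym (*-zeroʳ a)))
    ; (outside ∷ s) → eq s }

  δ⋀-∝ : {α : Λ M} {I : Subset M} {i : Fin M} → i ∈ I → α ∝ bas (I ∖ i) → δ i ⋀ α ∝ bas I
  δ⋀-∝ {α = α} {I} {i} i∈I (a , a≢0 , eq) with b , b≢0 , eq′ ← δ⋀bas i∈I =
    a * b , *-nonZero a≢0 b≢0 , λ s → begin
      (δ i ⋀ α) s                  ≡⟨ ⋀-congʳ (δ i) eq s ⟩
      (δ i ⋀ (a · bas (I ∖ i))) s  ≡⟨ ⋀-· (δ i) a (bas (I ∖ i)) s ⟩
      a * (δ i ⋀ bas (I ∖ i)) s    ≡⟨ cong (a *_) (eq′ s) ⟩
      a * (b * bas I s)            ≡⟨ sym (*-assoc a b (bas I s)) ⟩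
      a * b * bas I s              ∎

  ∖-∩ : (I J : Subset M) (i : Fin M) → I ∖ i ∩ J ≡ (I ∩ J) ∖ i
  ∖-∩ (_ ∷ I) (_ ∷ J) zero    = refl
  ∖-∩ (_ ∷ I) (_ ∷ J) (suc i) = cong (_ ∷_) (∖-∩ I J i)

  ∖-∩-∖ : (I J : Subset M) (i : Fin M) → I ∖ i ∩ J ∖ i ≡ (I ∩ J) ∖ i
  ∖-∩-∖ (_ ∷ I) (_ ∷ J) zero    = refl
  ∖-∩-∖ (_ ∷ I) (_ ∷ J) (suc i) = cong (_ ∷_) (∖-∩-∖ I J i)

  ∉⇒∖ : (p : Subset M) (i : Fin M) → i ∉ p → p ∖ i ≡ p
  ∉⇒∖ (inside ∷ p)  zero    i∉p = contradiction here i∉p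
  ∉⇒∖ (outside ∷ p) zero    i∉p = refl
  ∉⇒∖ (x ∷ p)       (suc i) i∉p = cong (x ∷_) (∉⇒∖ p i (i∉p ∘ there))

  ⊈⊎∣∩∣ : (I J : Subset M) → (∃ λ i → i ∈ I × i ∉ J) ⊎ ∣ I ∩ J ∣ ≡ ∣ I ∣
  ⊈⊎∣∩∣ [] [] = inj₂ refl
  ⊈⊎∣∩∣ (inside ∷ I) (outside ∷ J) = inj₁ (zero , here , λ ())
  ⊈⊎∣∩∣ (inside ∷ I) (inside ∷ J) with ⊈⊎∣∩∣ I J
  ... | inj₁ (i , i∈I , i∉J) = inj₁ (suc i , there i∈I , i∉J ∘ drop-there)
  ... | inj₂ eq = inj₂ (cong suc eq)
  ⊈⊎∣∩∣ (outside ∷ I) (y ∷ J) with ⊈⊎∣∩∣ I J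
  ... | inj₁ (i , i∈I , i∉J) = inj₁ (suc i , there i∈I , i∉J ∘ drop-there)
  ... | inj₂ eq = inj₂ eq

  -- Serves `realise` at a point lying in only one of the two sets. An element of `I` outside `J`
  -- can go without touching `I ∩ J`. If there is none, `I ∩ J` has as many elements as `I`, namely
  -- `suc a`, so a removal leaves `a`, which is at least `b`.
  removable : ∀ {a b} (I J : Subset M) → suc a ≡ ∣ I ∣ → b ≤ a → b ≤ ∣ I ∩ J ∣ →
              ∃ λ i → i ∈ I × b ≤ ∣ I ∖ i ∩ J ∣
  removable {a = a} {b} I J a≡ b≤a b≤ with ⊈⊎∣∩∣ I J
  ... | inj₁ (i , i∈I , i∉J) = i , i∈I ,
    subst (λ p → b ≤ ∣ p ∣) (sym (trans (∖-∩ I J i) (∉⇒∖ (I ∩ J) i (i∉J ∘ proj₂ ∘ x∈p∩q⁻ I J)))) b≤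
  ... | inj₂ eq with i , i∈ ← ∣p∣>0⇒∃∈ (I ∩ J) (subst (0 <_) (trans a≡ (sym eq)) (s≤s z≤n)) =
    i , proj₁ (x∈p∩q⁻ I J i∈) , subst (b ≤_) a≡′ b≤a
    where
    a≡′ : a ≡ ∣ I ∖ i ∩ J ∣
    a≡′ = trans (ℕ.suc-injective (trans a≡ (trans (sym eq) (∣p∖i∣ i∈)))) (cong ∣_∣ (sym (∖-∩ I J i)))

  ∣p∖i∣≡ : ∀ {a} {p : Subset M} {i : Fin M} → suc a ≡ ∣ p ∣ → i ∈ p → a ≡ ∣ p ∖ i ∣
  ∣p∖i∣≡ eq i∈p = ℕ.suc-injective (trans eq (∣p∖i∣ i∈p))

  ∣p∣≡0⇒p≡⊥ : (p : Subset M) → 0 ≡ ∣ p ∣ → p ≡ ⊥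
  ∣p∣≡0⇒p≡⊥ []            eq = refl
  ∣p∣≡0⇒p≡⊥ (outside ∷ p) eq = cong (outside ∷_) (∣p∣≡0⇒p≡⊥ p eq)

  _◂_ : Vector M → (Fin n → Vector M) → Fin (suc n) → Vector M
  (v ◂ V) zero    = v
  (v ◂ V) (suc j) = V j

  -- V maps A bijectively onto the basis vectors in I and B onto those in J; the elements
  -- outside A ∩ B use up I ∖ J and J ∖ I first, which keeps I ∩ J large enough.
  realise : (A B : Subset n) (I J : Subset M) → ∣ A ∣ ≡ ∣ I ∣ → ∣ B ∣ ≡ ∣ J ∣ →
            ∣ A ∩ B ∣ ≤ ∣ I ∩ J ∣ → ∃ λ V → ω V A ∝ bas I × ω V B ∝ bas J
  realise [] [] I J ∣I∣ ∣J∣ _ rewrite ∣p∣≡0⇒p≡⊥ I ∣I∣ | ∣p∣≡0⇒p≡⊥ J ∣J∣ =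
    (λ ()) , one , one
    where
    one : bas ⊥ ∝ bas ⊥
    one = 1ℤ , (λ ()) , λ s → sym (*-identityˡ (bas ⊥ s))
  realise (outside ∷ A) (outside ∷ B) I J ∣I∣ ∣J∣ le
    with V , a , b ← realise A B I J ∣I∣ ∣J∣ le = (λ _ → 0ℤ) ◂ V , a , b
  realise (inside ∷ A) (inside ∷ B) I J ∣I∣ ∣J∣ le
    with i , i∈ ← ∣p∣>0⇒∃∈ (I ∩ J) (ℕ.≤-trans (s≤s z≤n) le)
    with i∈I , i∈J ← x∈p∩q⁻ I J i∈
    with V , a , b ← realise A B (I ∖ i) (J ∖ i) (∣p∖i∣≡ ∣I∣ i∈I) (∣p∖i∣≡ ∣J∣ i∈J)
         (subst (λ p → ∣ A ∩ B ∣ ≤ ∣ p ∣) (sym (∖-∩-∖ I J i))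
           (ℕ.≤-pred (subst (suc ∣ A ∩ B ∣ ≤_) (∣p∖i∣ i∈) le)))
    = δ i ◂ V , δ⋀-∝ i∈I a , δ⋀-∝ i∈J b
  realise (inside ∷ A) (outside ∷ B) I J ∣I∣ ∣J∣ le
    with i , i∈I , le′ ← removable I J ∣I∣ (∣p∩q∣≤∣p∣ A B) le
    with V , a , b ← realise A B (I ∖ i) J (∣p∖i∣≡ ∣I∣ i∈I) ∣J∣ le′
    = δ i ◂ V , δ⋀-∝ i∈I a , b
  realise (outside ∷ A) (inside ∷ B) I J ∣I∣ ∣J∣ le
    with i , i∈J , le′ ← removable J I ∣J∣ (∣p∩q∣≤∣q∣ A B)
                           (subst (λ p → ∣ A ∩ B ∣ ≤ ∣ p ∣) (∩-comm I J) le)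
    with V , a , b ← realise A B I (J ∖ i) ∣I∣ (∣p∖i∣≡ ∣J∣ i∈J)
                       (subst (λ p → ∣ A ∩ B ∣ ≤ ∣ p ∣) (∩-comm (J ∖ i) I) le′)
    = δ i ◂ V , a , δ⋀-∝ i∈J b

  top-bas : ∀ t (I : Subset N) → top t (bas (replicate t inside ++ I)) ≗ bas I
  top-bas zero    I s = refl
  top-bas (suc t) I = top-bas t I

  top-∝ : ∀ t {α : Λ (t ℕ.+ N)} {I : Subset N} → α ∝ bas (replicate t inside ++ I) → top t α ∝ bas I
  top-∝ t {α} {I} (a , a≢0 , eq) = a , a≢0 , λ s → begin
    top t α s                                   ≡⟨ top-cong t eq s ⟩
    top t (a · bas (replicate t inside ++ I)) s ≡⟨ top-· t a (bas (replicate t inside ++ I)) s ⟩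
    a * top t (bas (replicate t inside ++ I)) s ≡⟨ cong (a *_) (top-bas t I s) ⟩
    a * bas I s                                 ∎

  ∣inside++p∣ : ∀ t (p : Subset N) → ∣ replicate t inside ++ p ∣ ≡ t ℕ.+ ∣ p ∣
  ∣inside++p∣ zero    p = refl
  ∣inside++p∣ (suc t) p = cong suc (∣inside++p∣ t p)

  t≤∣inside++∩∣ : ∀ t (p q : Subset N) → t ≤ ∣ (replicate t inside ++ p) ∩ (replicate t inside ++ q) ∣
  t≤∣inside++∩∣ zero    p q = z≤n
  t≤∣inside++∩∣ (suc t) p q = s≤s (t≤∣inside++∩∣ t p q)

  -- `A` and `B` are sent to basis vectors: both index sets contain the first `t`, and the remaining
  -- `d + d` are split into complementary halves `I` and `∁ I`. The common `t` elements leave room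
  -- for `A ∩ B`. `top` strips them off and a pairing of complementary monomials remains.
  Φ-nonvanishing : ∀ t d (A B : Subset n) → ∣ A ∣ ≡ t ℕ.+ d → ∣ B ∣ ≡ t ℕ.+ d → ∣ A ∩ B ∣ ≤ t →
                   ∃ λ (V : Fin n → Vector (t ℕ.+ (d ℕ.+ d))) → Φ t V A B ≢ 0ℤ
  Φ-nonvanishing t d A B ∣A∣ ∣B∣ le = conclude
    (realise A B (replicate t inside ++ I) (replicate t inside ++ ∁ I)
      (trans ∣A∣ (sym (trans (∣inside++p∣ t I) (cong (t ℕ.+_) ∣I∣))))
      (trans ∣B∣ (sym (trans (∣inside++p∣ t (∁ I)) (cong (t ℕ.+_) ∣∁I∣))))
      (ℕ.≤-trans le (t≤∣inside++∩∣ t I (∁ I))))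
    where
    I : Subset (d ℕ.+ d)
    I = replicate d inside ++ ⊥
    ∣I∣ : ∣ I ∣ ≡ d
    ∣I∣ = trans (∣inside++p∣ d ⊥) (trans (cong (d ℕ.+_) (∣⊥∣≡0 d)) (ℕ.+-identityʳ d))
    ∣∁I∣ : ∣ ∁ I ∣ ≡ d
    ∣∁I∣ = trans (∣∁p∣≡n∸∣p∣ I) (trans (cong (d ℕ.+ d ℕ.∸_) ∣I∣) (ℕ.m+n∸n≡m d d))
    conclude : (∃ λ V → ω V A ∝ bas (replicate t inside ++ I) × ω V B ∝ bas (replicate t inside ++ ∁ I)) →
               ∃ λ V → Φ t V A B ≢ 0ℤ
    conclude (V , ωA , ωB) with a , a≢0 , eqA ← top-∝ t ωA | b , b≢0 , eqB ← top-∝ t ωB =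
      V , λ Φ≡0 → *-nonZero a≢0 (*-nonZero b≢0 (⟪bas,bas∁⟫≢0 I)) (begin
        a * (b * ⟪ bas I , bas (∁ I) ⟫)   ≡⟨ cong (a *_) (sym (⟪⟫-·ʳ (bas I) b (bas (∁ I)))) ⟩
        a * ⟪ bas I , b · bas (∁ I) ⟫     ≡⟨ sym (⟪⟫-·ˡ a (bas I) (b · bas (∁ I))) ⟩
        ⟪ a · bas I , b · bas (∁ I) ⟫     ≡⟨ sym (⟪⟫-cong eqA eqB) ⟩
        Φ t V A B                         ≡⟨ Φ≡0 ⟩
        0ℤ                                ∎)

module Forcing where

  open import Defs
  open Pairing
  open Relation
  open import Data.Empty renaming (⊥ to Empty)
  open import Data.Nat as ℕ using (ℕ; zero; suc; _<_; _≤_; _∸_)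
  import Data.Nat.Properties as ℕ
  open import Data.Nat.Combinatorics using (_C_; nCk+nC[k+1]≡[n+1]C[k+1])
  open import Data.Integer as ℤ using (ℤ; +_; 0ℤ; 1ℤ; -1ℤ; _+_; _*_; -_)
  open import Data.Integer.Properties using (_≟_; +-identityˡ; +-identityʳ; *-comm; *-zeroʳ; abs-*; ∣-i∣≡∣i∣; ∣i∣≡0⇒i≡0)
  open import Data.Integer.Tactic.RingSolver using (solve-∀)
  open import Data.Fin using (Fin; zero; suc; _↑ˡ_; _↑ʳ_; splitAt)
  import Data.Fin.Properties as Fin
  open import Data.Fin.Subset using (Subset; ∣_∣; _∩_; inside; outside; ⊤)
  open import Data.Fin.Subset.Properties using (∣⊤∣≡n; ∩-idem)
  open import Data.List using (List; []; _∷_; length; map; _++_; lookup; filter; cartesianProduct)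
  open import Data.List.Properties using (length-map; length-++)
  open import Data.List.Membership.Propositional using (_∈_)
  open import Data.List.Membership.Propositional.Properties using (∈-map⁺; ∈-map⁻; ∈-++⁺ˡ; ∈-++⁺ʳ; ∈-++⁻; ∈-lookup; ∈-filter⁺; ∈-filter⁻; ∈-cartesianProduct⁺; ∈-cartesianProduct⁻)
  open import Data.List.Relation.Unary.All as All using (All; []; _∷_)
  open import Data.List.Relation.Unary.Any using (here; index)
  open import Data.List.Relation.Unary.Any.Properties using (lookup-index)
  open import Data.List.Relation.Unary.AllPairs using ([]; _∷_)
  open import Data.List.Relation.Unary.Unique.Propositional using (Unique)
  import Data.List.Relation.Unary.Unique.Propositional.Properties as Unique
  open import Data.Vec using ([]; _∷_)
  open import Data.Vec.Properties using (∷-injectiveʳ)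
  open import Data.Product using (∃; _×_; _,_; proj₁; proj₂)
  open import Data.Sum using (_⊎_; inj₁; inj₂; [_,_]′)
  open import Function using (_∘_)
  open import Relation.Nullary using (¬_; Dec; yes; no; contradiction)
  open import Relation.Binary.PropositionalEquality
  open ≡-Reasoning

  private variable
    n M N : ℕ

  -- Polynomial functions and generic vectors

  eval : List ℤ → ℕ → ℤ
  eval []       x = 0ℤ
  eval (a ∷ as) x = a + + x * eval as x

  -- One variable is enough, because generic vectors are found step by step along lines.
  IsPoly : (ℕ → ℤ) → Set
  IsPoly f = ∃ λ as → f ≗ eval as

  _+ᴾ_ : List ℤ → List ℤ → List ℤ
  []       +ᴾ bs       = bs
  (a ∷ as) +ᴾ []       = a ∷ as
  (a ∷ as) +ᴾ (b ∷ bs) = a + b ∷ as +ᴾ bs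

  _*ᴾ_ : List ℤ → List ℤ → List ℤ
  []       *ᴾ bs = []
  (a ∷ as) *ᴾ bs = map (a *_) bs +ᴾ (0ℤ ∷ as *ᴾ bs)

  eval-+ᴾ : ∀ as bs x → eval (as +ᴾ bs) x ≡ eval as x + eval bs x
  eval-+ᴾ []       bs       x = sym (+-identityˡ (eval bs x))
  eval-+ᴾ (a ∷ as) []       x = sym (+-identityʳ (eval (a ∷ as) x))
  eval-+ᴾ (a ∷ as) (b ∷ bs) x rewrite eval-+ᴾ as bs x = lemma a b (+ x) (eval as x) (eval bs x)
    where
    lemma : ∀ a b x p q → (a + b) + x * (p + q) ≡ (a + x * p) + (b + x * q)
    lemma = solve-∀

  eval-map* : ∀ a bs x → eval (map (a *_) bs) x ≡ a * eval bs x
  eval-map* a []       x = sym (*-zeroʳ a)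
  eval-map* a (b ∷ bs) x rewrite eval-map* a bs x = lemma a b (+ x) (eval bs x)
    where
    lemma : ∀ a b x q → a * b + x * (a * q) ≡ a * (b + x * q)
    lemma = solve-∀

  eval-*ᴾ : ∀ as bs x → eval (as *ᴾ bs) x ≡ eval as x * eval bs x
  eval-*ᴾ []       bs x = refl
  eval-*ᴾ (a ∷ as) bs x
    rewrite eval-+ᴾ (map (a *_) bs) (0ℤ ∷ as *ᴾ bs) x | eval-map* a bs x | eval-*ᴾ as bs x =
    lemma a (+ x) (eval as x) (eval bs x)
    where
    lemma : ∀ a x p q → a * q + (0ℤ + x * (p * q)) ≡ (a + x * p) * q
    lemma = solve-∀

  const-poly : ∀ a → IsPoly (λ _ → a)
  const-poly a = a ∷ [] , λ x → sym (trans (cong (_+_ a) (*-zeroʳ (+ x))) (+-identityʳ a))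

  var-poly : IsPoly (λ x → + x)
  var-poly = 0ℤ ∷ 1ℤ ∷ [] , λ x → lemma (+ x)
    where
    lemma : ∀ x → x ≡ 0ℤ + x * (1ℤ + x * 0ℤ)
    lemma = solve-∀

  +-poly : ∀ {f g} → IsPoly f → IsPoly g → IsPoly (λ x → f x + g x)
  +-poly (as , p) (bs , q) = as +ᴾ bs , λ x → trans (cong₂ _+_ (p x) (q x)) (sym (eval-+ᴾ as bs x))

  *-poly : ∀ {f g} → IsPoly f → IsPoly g → IsPoly (λ x → f x * g x)
  *-poly (as , p) (bs , q) = as *ᴾ bs , λ x → trans (cong₂ _*_ (p x) (q x)) (sym (eval-*ᴾ as bs x))

  -- Finitely many conditions of this kind are met together beyond the maximum of their thresholds,
  -- so no zeros have to be counted.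
  EventuallyNonzero : (ℕ → ℤ) → Set
  EventuallyNonzero f = ∃ λ K → ∀ x → K ≤ x → f x ≢ 0ℤ

  -- By Horner's scheme: once a nonzero value of eval as is multiplied by x > ∣ a ∣, adding a
  -- cannot cancel it.
  eval-dichotomy : ∀ as → (∀ x → eval as x ≡ 0ℤ) ⊎ EventuallyNonzero (eval as)
  eval-dichotomy [] = inj₁ λ _ → refl
  eval-dichotomy (a ∷ as) with eval-dichotomy as
  ... | inj₂ (K , h) = inj₂ (K ℕ.⊔ suc ℤ.∣ a ∣ , λ x le eq →
    dominated x (h x (ℕ.≤-trans (ℕ.m≤m⊔n K (suc ℤ.∣ a ∣)) le)) (ℕ.≤-trans (ℕ.m≤n⊔m K (suc ℤ.∣ a ∣)) le) eq)
    where
    dominated : ∀ x → eval as x ≢ 0ℤ → ℤ.∣ a ∣ < x → a + + x * eval as x ≢ 0ℤ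
    dominated x ne lt eq = ℕ.<⇒≱ lt (ℕ.≤-trans
      (ℕ.m≤m*n x ℤ.∣ eval as x ∣ {{ℕ.≢-nonZero (ne ∘ ∣i∣≡0⇒i≡0)}})
      (ℕ.≤-reflexive (begin
        x ℕ.* ℤ.∣ eval as x ∣ ≡⟨ sym (abs-* (+ x) (eval as x)) ⟩
        ℤ.∣ + x * eval as x ∣ ≡⟨ cong ℤ.∣_∣ (lemma a (+ x * eval as x) eq) ⟩
        ℤ.∣ - a ∣             ≡⟨ ∣-i∣≡∣i∣ a ⟩
        ℤ.∣ a ∣               ∎)))
      where
      lemma : ∀ a y → a + y ≡ 0ℤ → y ≡ - a
      lemma a y eq = trans (lemma₀ a y) (trans (cong (_+_ (- a)) eq) (+-identityʳ (- a)))
        where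
        lemma₀ : ∀ a y → y ≡ - a + (a + y)
        lemma₀ = solve-∀
  ... | inj₁ h with a ≟ 0ℤ
  ...   | yes refl = inj₁ λ x → trans (+-identityˡ (+ x * eval as x)) (trans (cong (+ x *_) (h x)) (*-zeroʳ (+ x)))
  ...   | no a≢0   = inj₂ (0 , λ x _ eq → a≢0 (begin
    a                   ≡⟨ sym (+-identityʳ a) ⟩
    a + 0ℤ              ≡⟨ cong (_+_ a) (sym (trans (cong (+ x *_) (h x)) (*-zeroʳ (+ x)))) ⟩
    a + + x * eval as x ≡⟨ eq ⟩
    0ℤ                  ∎))

  poly-eventually : ∀ {f} → IsPoly f → ∀ x → f x ≢ 0ℤ → EventuallyNonzero f
  poly-eventually (as , p) x fx≢0 with eval-dichotomy as
  ... | inj₁ h       = contradiction (trans (p x) (h x)) fx≢0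
  ... | inj₂ (K , h) = K , λ y le eq → h y le (trans (sym (p y)) eq)

  -- Polynomial dependence of the pairing on the vectors

  ⋀-poly : (v : ℕ → Vector M) (α : ℕ → Λ M) → (∀ r → IsPoly (λ x → v x r)) →
           (∀ s → IsPoly (λ x → α x s)) → ∀ s → IsPoly (λ x → (v x ⋀ α x) s)
  ⋀-poly v α pv pα []            = const-poly 0ℤ
  ⋀-poly v α pv pα (inside ∷ s)  =
    +-poly (*-poly (pv zero) (pα (outside ∷ s)))
      (*-poly (const-poly -1ℤ)
        (⋀-poly (λ x → v x ∘ suc) (λ x → hd (α x)) (pv ∘ suc) (pα ∘ (inside ∷_)) s))
  ⋀-poly v α pv pα (outside ∷ s) =
    ⋀-poly (λ x → v x ∘ suc) (λ x → tl (α x)) (pv ∘ suc) (pα ∘ (outside ∷_)) s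

  ω-poly : (V : ℕ → Fin n → Vector M) → (∀ j r → IsPoly (λ x → V x j r)) →
           ∀ A s → IsPoly (λ x → ω (V x) A s)
  -- The empty product does not depend on the vectors, so its value at parameter 0 serves as the
  -- constant.
  ω-poly V pV []            s = const-poly (ω (V 0) [] s)
  ω-poly V pV (inside ∷ A)  s =
    ⋀-poly (λ x → V x zero) (λ x → ω (V x ∘ suc) A) (pV zero) (ω-poly (λ x → V x ∘ suc) (pV ∘ suc) A) s
  ω-poly V pV (outside ∷ A) s = ω-poly (λ x → V x ∘ suc) (pV ∘ suc) A s

  top-poly : ∀ t (α : ℕ → Λ (t ℕ.+ N)) → (∀ s → IsPoly (λ x → α x s)) →
             ∀ s → IsPoly (λ x → top t (α x) s)
  top-poly zero    α pα = pα
  top-poly (suc t) α pα = top-poly t (λ x → hd (α x)) (pα ∘ (inside ∷_))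

  ⟪⟫-poly : (α β : ℕ → Λ M) → (∀ s → IsPoly (λ x → α x s)) → (∀ s → IsPoly (λ x → β x s)) →
            IsPoly (λ x → ⟪ α x , β x ⟫)
  ⟪⟫-poly {zero}  α β pα pβ = *-poly (pα []) (pβ [])
  ⟪⟫-poly {suc M} α β pα pβ = +-poly
    (⟪⟫-poly (λ x → hd (α x)) (λ x → tl (β x)) (pα ∘ (inside ∷_)) (pβ ∘ (outside ∷_)))
    (⟪⟫-poly (λ x → ε (tl (α x))) (λ x → hd (β x))
      (λ s → *-poly (const-poly (σ s)) (pα (outside ∷ s))) (pβ ∘ (inside ∷_)))

  Φ-poly : ∀ t (V : ℕ → Fin n → Vector (t ℕ.+ N)) → (∀ j r → IsPoly (λ x → V x j r)) →
           ∀ A B → IsPoly (λ x → Φ t (V x) A B)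
  Φ-poly t V pV A B = ⟪⟫-poly (λ x → top t (ω (V x) A)) (λ x → top t (ω (V x) B))
    (top-poly t (λ x → ω (V x) A) (ω-poly V pV A)) (top-poly t (λ x → ω (V x) B) (ω-poly V pV B))

  ω-cong : {V W : Fin n → Vector M} → (∀ j → V j ≗ W j) → ∀ A → ω V A ≗ ω W A
  ω-cong eq []            s = refl
  ω-cong eq (inside ∷ A)    = ⋀-cong (eq zero) (ω-cong (eq ∘ suc) A)
  ω-cong eq (outside ∷ A)   = ω-cong (eq ∘ suc) A

  -- Needed at the parameters 0 and 1 of a line, where it agrees with `V` and `W` only pointwise.
  Φ-cong : ∀ t {V W : Fin n → Vector (t ℕ.+ N)} → (∀ j → V j ≗ W j) → ∀ A B → Φ t V A B ≡ Φ t W A B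
  Φ-cong t eq A B = ⟪⟫-cong (top-cong t (ω-cong eq A)) (top-cong t (ω-cong eq B))

  line : (V W : Fin n → Vector M) → ℕ → Fin n → Vector M
  line V W x j r = V j r + + x * (W j r + - V j r)

  line-poly : (V W : Fin n → Vector M) → ∀ j r → IsPoly (λ x → line V W x j r)
  line-poly V W j r = +-poly (const-poly (V j r)) (*-poly var-poly (const-poly (W j r + - V j r)))

  line-0 : (V W : Fin n → Vector M) → ∀ j → line V W 0 j ≗ V j
  line-0 V W j r = +-identityʳ (V j r)

  line-1 : (V W : Fin n → Vector M) → ∀ j → line V W 1 j ≗ W j
  line-1 V W j r = lemma (V j r) (W j r)
    where
    lemma : ∀ v w → v + 1ℤ * (w + - v) ≡ w
    lemma = solve-∀

  eventually-all : {X : Set} (f : X → ℕ → ℤ) {xs : List X} → All (EventuallyNonzero ∘ f) xs →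
                   ∃ λ K → ∀ y → K ≤ y → All (λ x → f x y ≢ 0ℤ) xs
  eventually-all f []              = 0 , λ _ _ → []
  eventually-all f ((K , h) ∷ hs) with K′ , h′ ← eventually-all f hs =
    K ℕ.⊔ K′ , λ y le → h y (ℕ.≤-trans (ℕ.m≤m⊔n K K′) le) ∷ h′ y (ℕ.≤-trans (ℕ.m≤n⊔m K K′) le)

  -- If V is good for ps and W for p₀, then all but finitely many points of the line through
  -- V and W are good for both.
  Φ-generic : ∀ t (ps : List (Subset n × Subset n)) →
              All (λ (A , B) → ∃ λ (V : Fin n → Vector (t ℕ.+ N)) → Φ t V A B ≢ 0ℤ) ps →
              ∃ λ (V : Fin n → Vector (t ℕ.+ N)) → All (λ (A , B) → Φ t V A B ≢ 0ℤ) ps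
  Φ-generic t []             []              = (λ _ _ → 0ℤ) , []
  Φ-generic {n} {N} t (p₀ ∷ ps) ((W , W-good) ∷ hs) with V , V-good ← Φ-generic t ps hs =
    line V W K , h K ℕ.≤-refl
    where
    f : Subset n × Subset n → ℕ → ℤ
    f (A , B) x = Φ t (line V W x) A B
    eventually : ∀ p x → f p x ≢ 0ℤ → EventuallyNonzero (f p)
    eventually (A , B) = poly-eventually (Φ-poly t (line V W) (line-poly V W) A B)
    combined : ∃ λ K → ∀ y → K ≤ y → All (λ p → f p y ≢ 0ℤ) (p₀ ∷ ps)
    combined = eventually-all f
      (eventually p₀ 1 (λ eq → W-good (trans (sym (Φ-cong t (line-1 V W) (proj₁ p₀) (proj₂ p₀))) eq))
      ∷ All.map (λ {p} good → eventually p 0 λ eq →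
          good (trans (sym (Φ-cong t (line-0 V W) (proj₁ p) (proj₂ p))) eq)) V-good)
    K = proj₁ combined
    h = proj₂ combined

  -- The kernel argument

  subsets : ∀ n → ℕ → List (Subset n)
  subsets zero    zero    = [] ∷ []
  subsets zero    (suc k) = []
  subsets (suc n) zero    = map (outside ∷_) (subsets n zero)
  subsets (suc n) (suc k) = map (inside ∷_) (subsets n k) ++ map (outside ∷_) (subsets n (suc k))

  length-subsets : ∀ n k → length (subsets n k) ≡ n C k
  length-subsets zero    zero    = refl
  length-subsets zero    (suc k) = refl
  length-subsets (suc n) zero    = trans (length-map (outside ∷_) (subsets n zero)) (length-subsets n zero)
  length-subsets (suc n) (suc k) = begin
    length (map (inside ∷_) (subsets n k) ++ map (outside ∷_) (subsets n (suc k)))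
      ≡⟨ length-++ (map (inside ∷_) (subsets n k)) ⟩
    length (map (inside ∷_) (subsets n k)) ℕ.+ length (map (outside ∷_) (subsets n (suc k)))
      ≡⟨ cong₂ ℕ._+_ (trans (length-map (inside ∷_) (subsets n k)) (length-subsets n k))
           (trans (length-map (outside ∷_) (subsets n (suc k))) (length-subsets n (suc k))) ⟩
    n C k ℕ.+ n C suc k
      ≡⟨ nCk+nC[k+1]≡[n+1]C[k+1] n k ⟩
    suc n C suc k ∎

  -- Stated at `∣ s ∣` itself, so that the cardinality, on which `subsets` branches, can be
  -- abstracted together with the induction hypothesis.
  ∈-subsets-∣∣ : (s : Subset n) → s ∈ subsets n ∣ s ∣
  ∈-subsets-∣∣ []            = here refl
  ∈-subsets-∣∣ (inside ∷ s)  = ∈-++⁺ˡ (∈-map⁺ (inside ∷_) (∈-subsets-∣∣ s))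
  ∈-subsets-∣∣ (outside ∷ s) with ∣ s ∣ | ∈-subsets-∣∣ s
  ... | zero  | s∈ = ∈-map⁺ (outside ∷_) s∈
  ... | suc k | s∈ = ∈-++⁺ʳ (map (inside ∷_) (subsets _ k)) (∈-map⁺ (outside ∷_) s∈)

  ∈-subsets⁺ : ∀ {k} (s : Subset n) → ∣ s ∣ ≡ k → s ∈ subsets n k
  ∈-subsets⁺ s refl = ∈-subsets-∣∣ s

  ∈-subsets⁻ : ∀ n k {s : Subset n} → s ∈ subsets n k → ∣ s ∣ ≡ k
  ∈-subsets⁻ zero    zero    (here refl) = refl
  ∈-subsets⁻ (suc n) zero    s∈ with s , s∈ , refl ← ∈-map⁻ (outside ∷_) s∈ = ∈-subsets⁻ n zero s∈
  ∈-subsets⁻ (suc n) (suc k) s∈ with ∈-++⁻ (map (inside ∷_) (subsets n k)) s∈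
  ... | inj₁ s∈ with s , s∈ , refl ← ∈-map⁻ (inside ∷_) s∈ = cong suc (∈-subsets⁻ n k s∈)
  ... | inj₂ s∈ with s , s∈ , refl ← ∈-map⁻ (outside ∷_) s∈ = ∈-subsets⁻ n (suc k) s∈

  subsets-unique : ∀ n k → Unique (subsets n k)
  subsets-unique zero    zero    = [] ∷ []
  subsets-unique zero    (suc k) = []
  subsets-unique (suc n) zero    = Unique.map⁺ ∷-injectiveʳ (subsets-unique n zero)
  subsets-unique (suc n) (suc k) = Unique.++⁺
    (Unique.map⁺ ∷-injectiveʳ (subsets-unique n k))
    (Unique.map⁺ ∷-injectiveʳ (subsets-unique n (suc k))) disjoint
    where
    disjoint : ∀ {s} → ¬ (s ∈ map (inside ∷_) (subsets n k) × s ∈ map (outside ∷_) (subsets n (suc k)))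
    disjoint (p , q) with _ , _ , refl ← ∈-map⁻ (inside ∷_) p with _ , _ , () ← ∈-map⁻ (outside ∷_) q

  lookup-injective : {X : Set} {xs : List X} → Unique xs → ∀ i j → lookup xs i ≡ lookup xs j → i ≡ j
  lookup-injective (_ ∷ _)  zero    zero    eq = refl
  lookup-injective (x∉ ∷ _) zero    (suc j) eq = contradiction eq (All.lookup x∉ (∈-lookup j))
  lookup-injective (x∉ ∷ _) (suc i) zero    eq = contradiction (sym eq) (All.lookup x∉ (∈-lookup i))
  lookup-injective (_ ∷ u)  (suc i) (suc j) eq = cong suc (lookup-injective u i j eq)

  -- The linear system attached to a zero forcing set

  module Kernel (n t d : ℕ) (t<k : t < t ℕ.+ d) (B : List (KSubset n (t ℕ.+ d)))
                (forcing : IsZeroForcingSet (JAdj n (t ℕ.+ d) (UpTo t)) B) where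

    k : ℕ
    k = t ℕ.+ d

    Vertex : Set
    Vertex = KSubset n k

    vertices : List (Subset n)
    vertices = subsets n k

    ∣V∣ : ℕ
    ∣V∣ = length vertices

    vertex : Fin ∣V∣ → Vertex
    vertex j = lookup vertices j , ∈-subsets⁻ n k (∈-lookup j)

    vertex∈ : (v : Vertex) → proj₁ v ∈ vertices
    vertex∈ (s , ∣s∣≡k) = ∈-subsets⁺ s ∣s∣≡k

    position : Vertex → Fin ∣V∣
    position v = index (vertex∈ v)

    -- The list of vertices has no repetitions, so an index found for an entry is the index it came
    -- from.
    position-vertex : ∀ j → position (vertex j) ≡ j
    position-vertex j = lookup-injective (subsets-unique n k) (position (vertex j)) j
      (sym (lookup-index (vertex∈ (vertex j))))

    small? : (p : Subset n × Subset n) → Dec (∣ proj₁ p ∩ proj₂ p ∣ ≤ t)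
    small? (A , B) = ∣ A ∩ B ∣ ℕ.≤? t

    -- One family of vectors must serve all edges at once; genericity provides it because these
    -- pairs form a finite list.
    pairs : List (Subset n × Subset n)
    pairs = filter small? (cartesianProduct vertices vertices)

    generic : ∃ λ (V : Fin n → Vector (t ℕ.+ (d ℕ.+ d))) → All (λ (A , B) → Φ t V A B ≢ 0ℤ) pairs
    generic = Φ-generic t pairs (All.tabulate λ {(A , B)} AB∈ →
      let AB∈′ , le = ∈-filter⁻ small? AB∈
          A∈ , B∈   = ∈-cartesianProduct⁻ vertices vertices AB∈′
      in Φ-nonvanishing t d A B (∈-subsets⁻ n k A∈) (∈-subsets⁻ n k B∈) le)

    V : Fin n → Vector (t ℕ.+ (d ℕ.+ d))
    V = proj₁ generic

    Φ-adjacent : (u v : Vertex) → ∣ proj₁ u ∩ proj₁ v ∣ ≤ t → Φ t V (proj₁ u) (proj₁ v) ≢ 0ℤ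
    Φ-adjacent u v le = All.lookup (proj₂ generic)
      (∈-filter⁺ small? (∈-cartesianProduct⁺ (vertex∈ u) (vertex∈ v)) le)

    β : Fin ∣V∣ → Λ (d ℕ.+ d)
    β j = top t (ω V (proj₁ (vertex j)))

    β-degree : ∀ j → HasDegree d (β j)
    β-degree j = top-degree t (subst (λ e → HasDegree e (ω V (proj₁ (vertex j)))) (proj₂ (vertex j))
      (ω-degree V (proj₁ (vertex j))))

    monomials : List (Subset (d ℕ.+ d))
    monomials = subsets (d ℕ.+ d) d

    blackEq : Fin (length B) → Vector ∣V∣
    blackEq i = δ (position (lookup B i))

    coordEq : Fin (length monomials) → Vector ∣V∣
    coordEq i j = β j (lookup monomials i)

    -- The unknowns are the entries x_j at the vertices. The first equations make x vanish on `B`;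
    -- the others, one for each of the C(2d,d) monomials, express Σ x_j `β j` = 0.
    equations : Fin (length B ℕ.+ length monomials) → Vector ∣V∣
    equations i = [ blackEq , coordEq ]′ (splitAt (length B) i)

    module _ (R : Relation equations ⊤) where

      x : Vector ∣V∣
      x = coeff R

      black-zero : ∀ i → x (position (lookup B i)) ≡ 0ℤ
      black-zero i = begin
        x (position (lookup B i))             ≡⟨ sym (∙-δʳ x (position (lookup B i))) ⟩
        x ∙ blackEq i                         ≡⟨ cong (λ z → x ∙ [ blackEq , coordEq ]′ z)
                                                   (sym (Fin.splitAt-↑ˡ (length B) i (length monomials))) ⟩
        x ∙ equations (i ↑ˡ length monomials) ≡⟨ vanishing R (i ↑ˡ length monomials) ⟩
        0ℤ                                    ∎

      coord-zero : ∀ i → x ∙ coordEq i ≡ 0ℤ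
      coord-zero i = begin
        x ∙ coordEq i                         ≡⟨ cong (λ z → x ∙ [ blackEq , coordEq ]′ z)
                                                   (sym (Fin.splitAt-↑ʳ (length B) (length monomials) i)) ⟩
        x ∙ equations (length B ↑ʳ i)         ≡⟨ vanishing R (length B ↑ʳ i) ⟩
        0ℤ                                    ∎

      -- Coordinates of size `d` are among the equations; at all others every `β j` vanishes by
      -- degree.
      Σxβ≡0 : ∀ s → x ∙ (λ j → β j s) ≡ 0ℤ
      Σxβ≡0 s = case (∣ s ∣ ℕ.≟ d)
        where
        case : Dec (∣ s ∣ ≡ d) → x ∙ (λ j → β j s) ≡ 0ℤ
        case (yes eq) = trans (cong (λ z → x ∙ (λ j → β j z)) (lookup-index s∈)) (coord-zero (index s∈))
          where
          s∈ : s ∈ monomials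
          s∈ = ∈-subsets⁺ s eq
        case (no ne)  = sum-zero (λ j → x j * β j s)
          λ j → trans (cong (x j *_) (β-degree j s ne)) (*-zeroʳ (x j))

      kernel : (u : Vertex) → x ∙ (λ j → Φ t V (proj₁ u) (proj₁ (vertex j))) ≡ 0ℤ
      kernel u = begin
        x ∙ (λ j → ⟪ α , β j ⟫)          ≡⟨ sym (⟪⟫-sumʳ α x β) ⟩
        ⟪ α , (λ s → x ∙ (λ j → β j s)) ⟫ ≡⟨ ⟪⟫-congʳ α Σxβ≡0 ⟩
        ⟪ α , (λ _ → 0ℤ) ⟫               ≡⟨ ⟪⟫-zeroʳ α ⟩
        0ℤ                               ∎
        where
        α : Λ (d ℕ.+ d)
        α = top t (ω V (proj₁ u))

      forced-zero : ∀ {v} → Forced (JAdj n k (UpTo t)) B v → x (position v) ≡ 0ℤ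
      forced-zero (initial v∈B) =
        trans (cong (x ∘ position) (lookup-index v∈B)) (black-zero (index v∈B))
      forced-zero (force {u} {w} _ (_ , u∩w≤t) others) =
        -- `w` and `vertex p` are identified only through their underlying sets, so the bound on the
        -- intersection is transported along that equality.
        *-cancel-zero (Φ-adjacent u (vertex p) (subst (λ s → ∣ proj₁ u ∩ s ∣ ≤ t) (lookup-index (vertex∈ w)) u∩w≤t)) (begin
          φ p * x p                 ≡⟨ *-comm (φ p) (x p) ⟩
          x p * φ p                 ≡⟨ sym (sum-single (λ j → x j * φ j) p
                                      λ j j≢p → case j j≢p (∣ proj₁ u ∩ proj₁ (vertex j) ∣ ℕ.≤? t)) ⟩
          x ∙ φ                     ≡⟨ kernel u ⟩
          0ℤ                        ∎)
        where
        p : Fin ∣V∣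
        p = position w
        φ : Vector ∣V∣
        φ j = Φ t V (proj₁ u) (proj₁ (vertex j))
        -- The other terms of row `u` vanish: a large intersection kills the pairing, and a small
        -- one makes `vertex j` a neighbour of `u` other than `w`, to which the induction hypothesis
        -- applies.
        case : ∀ j → j ≢ p → Dec (∣ proj₁ u ∩ proj₁ (vertex j) ∣ ≤ t) → x j * φ j ≡ 0ℤ
        case j j≢p (no gt)  = trans (cong (x j *_) (Φ-vanishes t V (proj₁ u) (proj₁ (vertex j)) (ℕ.≰⇒> gt))) (*-zeroʳ (x j))
        case j j≢p (yes le) = cong (_* φ j) (trans (cong x (sym (position-vertex j)))
          (forced-zero (others (vertex j) (u≢ , le) λ eq →
            j≢p (trans (sym (position-vertex j)) (cong position eq)))))
          where
          -- The diagonal: `u` meets itself in `k` elements, and `t < k`.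
          u≢ : proj₁ u ≢ proj₁ (vertex j)
          u≢ eq = ℕ.<⇒≱ t<k (subst (_≤ t)
            (trans (cong (λ s → ∣ proj₁ u ∩ s ∣) (sym eq)) (trans (cong ∣_∣ (∩-idem (proj₁ u))) (proj₂ u))) le)

      -- Every vertex is forced, so even the pivot entry of x would be zero.
      no-relation : Empty
      no-relation = nonzero R
        (trans (cong x (sym (position-vertex (pivot R)))) (forced-zero (forcing (vertex (pivot R)))))

    bound : n C k ∸ (d ℕ.+ d) C d ≤ length B
    -- The subtraction is moved to the other side as C(n,k) ≤ C(2d,d) + ∣B∣; if this fails, there
    -- are fewer equations than unknowns.
    bound = ℕ.m≤n+o⇒m∸n≤o (n C k) ((d ℕ.+ d) C d) (ℕ.≮⇒≥ λ lt →
      no-relation (nontrivial-relation equations ⊤ (count lt)))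
      where
      count : (d ℕ.+ d) C d ℕ.+ length B < n C k → length B ℕ.+ length monomials < ∣ ⊤ {∣V∣} ∣
      count = subst₂ _<_
        (trans (ℕ.+-comm ((d ℕ.+ d) C d) (length B)) (cong (length B ℕ.+_) (sym (length-subsets (d ℕ.+ d) d))))
        (sym (trans (∣⊤∣≡n ∣V∣) (length-subsets n k)))

  2[t+d]∸2t≡d+d : ∀ t d → 2 ℕ.* (t ℕ.+ d) ∸ 2 ℕ.* t ≡ d ℕ.+ d
  2[t+d]∸2t≡d+d t d = begin
    2 ℕ.* (t ℕ.+ d) ∸ 2 ℕ.* t ≡⟨ sym (ℕ.*-distribˡ-∸ 2 (t ℕ.+ d) t) ⟩
    2 ℕ.* (t ℕ.+ d ∸ t)       ≡⟨ cong (2 ℕ.*_) (ℕ.m+n∸m≡n t d) ⟩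
    d ℕ.+ (d ℕ.+ 0)           ≡⟨ cong (d ℕ.+_) (ℕ.+-identityʳ d) ⟩
    d ℕ.+ d                   ∎

  -- With `d` and its equation as separate arguments, matching on `refl` turns `k` into `t + d`
  -- inside the types of `B` and `forcing`.
  forcing-bound : ∀ {n k} t d → t ℕ.+ d ≡ k → t < k → (B : List (KSubset n k)) →
                  IsZeroForcingSet (JAdj n k (UpTo t)) B →
                  (n C k) ∸ ((2 ℕ.* k ∸ 2 ℕ.* t) C d) ≤ length B
  forcing-bound {n} t d refl t<k B forcing =
    subst (λ N → (n C (t ℕ.+ d)) ∸ (N C d) ≤ length B) (sym (2[t+d]∸2t≡d+d t d))
      (Kernel.bound n t d t<k B forcing)

open import Defs
open import Data.Nat using (ℕ; _≤_; _<_; _+_; _*_; _∸_; suc)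
open import Data.Nat.Combinatorics using (_C_)
open import Data.Nat.Properties using (m+[n∸m]≡n; <⇒≤)
open import Data.Product using (proj₁)
open import Data.List using (List; map; length)
open import Data.List.Relation.Unary.Unique.Propositional using (Unique)

theorem4p4 : (n k t : ℕ) → 1 ≤ k → 2 * k + 1 ≤ n → t < k →
    (B : List (KSubset n k)) → Unique (map proj₁ B) →
    IsZeroForcingSet (JAdj n k (UpTo t)) B →
    (n C k) ∸ ((2 * k ∸ 2 * t) C (k ∸ t)) ≤ length B
theorem4p4 n k t _ _ t<k B _ forcing =
  Forcing.forcing-bound t (k ∸ t) (m+[n∸m]≡n (<⇒≤ t<k)) t<k B forcing
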